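{- Consider any execution of the algorithm DMTF given in the context, by $p$ asynchronous processes that may crash. Linearization points can be assigned to all completed SEARCH operations, each lying between the beginning and the end of the operation, so that for every completed operation SEARCH($e$): if $e$ is in the set, then when the operation is linearized a node containing $e$ is at the front of the list and the operation returns a pointer to this node; otherwise (if $e$ is not in the set), the operation returns "not present". (The linearization points are those described in the context.)
   Context: Model: asynchronous shared memory with $p$ processes $p_1,\dots,p_p$ performing atomic reads, writes and compare-and-swap. CAS($x$, old, new) atomically returns the value of $x$ and, if it equals old, changes $x$ to new. Each individual shared-memory access is one atomic step. Processes run at arbitrarily varying speeds and may crash. Each process repeatedly and sequentially invokes SEARCH($e$) for arguments $e\neq\bot$. Data structure: a fixed (static) set of at least two items is stored in a doubly linked list of nodes. Each node has fields item (never changed), next, prev, old, new. Pointer-valued fields may hold NULL; the field old may hold the special value DONE and the field new the special value GONE. The object Head holds a pair of pointers, to the first and second nodes of the list. "The front of the list" is the node pointed to by the first component of Head. Each process $p_i$ has an announcement object $A[i]$ holding a pair. Initially, the list consists of exactly one node for each item of the set, correctly doubly linked (the last node has next $=$ NULL and the first has prev $=$ NULL), every node has old $=$ DONE and new $=$ NULL, and $A[i]=(\mathrm{NULL},\bot)$ for all $i$. allocate(node) always returns a pointer to a fresh node. $\phi\ge1$ is an integer constant. For a pointer $h$, $h.f$ denotes field $f$ of the node it points to. SEARCH($e$) by process $p_i$: (S1) $g\leftarrow$ allocate(node); $g.item\leftarrow e$; set $g.prev$, $g.next$, $g.old$, $g.new$ to NULL. (S2) [announce] CAS($A[i]$, $(\mathrm{NULL},\bot)$,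 $(g,e)$). (S3) $(h_1,h)\leftarrow$ Head. (S4) If $h_1.item=e$ then: $(a,b)\leftarrow$ CAS($A[i]$, $(g,e)$, $(\mathrm{NULL},\bot)$); if $b=\bot$ then CAS($A[i]$, $(a,b)$, $(\mathrm{NULL},\bot)$); return $h_1$. (S5) $c\leftarrow0$. While $h\ne$ NULL do: (i) if $h.item=e$ then: $(a,b)\leftarrow A[i]$; if $b=\bot$ then {CAS($A[i]$, $(a,b)$, $(\mathrm{NULL},\bot)$); return $a$}; CAS($g.old$, NULL, $h$); CAS($h.new$, NULL, $g$); $g'\leftarrow h.new$; if $g'\ne$ GONE then MOVE-TO-FRONT($g'$); $(a,b)\leftarrow A[i]$; CAS($A[i]$, $(a,b)$, $(\mathrm{NULL},\bot)$); return $a$. (ii) $c\leftarrow(c+1)\bmod\phi$. (iii) if $c=0$ then: $(a,b)\leftarrow A[i]$; if $b=\bot$ then {CAS($A[i]$, $(a,b)$, $(\mathrm{NULL},\bot)$); return $a$}. (iv) $h\leftarrow h.next$. (S6) (End of list reached.) $(a,b)\leftarrow A[i]$; CAS($A[i]$, $(a,b)$, $(\mathrm{NULL},\bot)$); if $b=\bot$ then return $a$, else return "not present". MOVE-TO-FRONT($g'$): while $g'.old\ne$ DONE do: $(h_1,h_2)\leftarrow$ Head; $h'\leftarrow h_1.old$; if $h'=$ DONE then {if $g'.old\ne$ DONE then CAS(Head, $(h_1,h_2)$, $(g',h_1)$)} else {CAS($h_1.next$, NULL, $h_2$); CAS($h_2.prev$, NULL, $h_1$); $e'\leftarrow h_1.item$;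 for every process index $j$ do {$(a,b)\leftarrow A[j]$; if $b=e'$ and $h_1.old\ne$ DONE then CAS($A[j]$, $(a,b)$, $(h_1,\bot)$)}; $pred\leftarrow h'.prev$; $succ\leftarrow h'.next$; CAS($pred.next$, $h'$, $succ$); if $succ\ne$ NULL then CAS($succ.prev$, $h'$, $pred$); CAS($h'.new$, $h_1$, GONE); CAS($h_1.old$, $h'$, DONE)}. When the loop ends, return. Linearization points: a SEARCH($e$) with $e$ not in the set is linearized at any point during its operation interval (for example, when it returns). A SEARCH($e$) that returns in step (S4) is linearized when it reads Head in step (S3). Any other completed SEARCH($e$) with $e$ in the set, returning a pointer to a node $v$, is linearized at a point after its announcement in step (S2) and before it returns at which $v$ is at the front of the list. -}

module Defs where

open import Data.Bool using (if_then_else_)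
open import Data.Fin using (Fin)
open import Data.List using (List; []; _∷_; head; map; allFin)
open import Data.List.Membership.Propositional using (_∈_; _∉_)
open import Data.List.Relation.Binary.Permutation.Propositional using (_↭_)
open import Data.List.Relation.Unary.All using (All)
open import Data.Maybe using (Maybe; just; nothing)
import Data.Maybe.Properties as Maybe
open import Data.Nat as ℕ using (ℕ; suc; _<_; _≤_; NonZero)
open import Data.Nat.DivMod using (_%_)
open import Data.Product using (_×_; _,_; proj₁; ∃-syntax)
import Data.Product.Properties as Product
open import Data.Unit using (⊤)
open import Data.Vec.Functional using (updateAt)
open import Relation.Binary using (DecidableEquality)
open import Relation.Binary.PropositionalEquality using (_≡_; _≢_; refl; cong)
open import Relation.Nullary using (¬_; yes; no; does)
open import Relation.Nullary.Decidable using (map′)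

Addr : Set
Addr = ℕ

-- nothing is NULL.
Ptr : Set
Ptr = Maybe Addr

data Old : Set where
  ptr  : Ptr → Old
  DONE : Old

data New : Set where
  ptr  : Ptr → New
  GONE : New

_≟ᴾ_ : DecidableEquality Ptr
_≟ᴾ_ = Maybe.≡-dec ℕ._≟_

_≟ᴼ_ : DecidableEquality Old
ptr x ≟ᴼ ptr y = map′ (cong ptr) (λ { refl → refl }) (x ≟ᴾ y)
ptr _ ≟ᴼ DONE  = no λ ()
DONE  ≟ᴼ ptr _ = no λ ()
DONE  ≟ᴼ DONE  = yes refl

_≟ᴺ_ : DecidableEquality New
ptr x ≟ᴺ ptr y = map′ (cong ptr) (λ { refl → refl }) (x ≟ᴾ y)
ptr _ ≟ᴺ GONE  = no λ ()
GONE  ≟ᴺ ptr _ = no λ ()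
GONE  ≟ᴺ GONE  = yes refl

-- The value of a cell after CAS(cell, old, new), where x is its value before.
cas : {X : Set} → DecidableEquality X → (old new x : X) → X
cas _≟_ old new x = if does (x ≟ old) then new else x

module DMTF (Item : Set) (_≟_ : DecidableEquality Item)
            (p φ : ℕ) .{{_ : NonZero φ}} (items : List Item) where

  record Node : Set where
    field
      item : Item
      next : Ptr
      prev : Ptr
      old  : Old
      new  : New

  open Node public

  -- In the second component, nothing is ⊥.
  Announcement : Set
  Announcement = Ptr × Maybe Item

  _≟ᴬ_ : DecidableEquality Announcement
  _≟ᴬ_ = Product.≡-dec _≟ᴾ_ (Maybe.≡-dec _≟_)

  -- heap is total: the contents of addresses that have not been allocated
  -- are arbitrary.
  record Memory : Set where
    field
      heap      : Addr → Node
      Head      : Ptr × Ptr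
      A         : Fin p → Announcement
      allocated : List Addr

  open Memory public

  modify : Addr → (Node → Node) → Memory → Memory
  modify a f m = record m
    { heap = λ x → if does (x ℕ.≟ a) then f (heap m x) else heap m x }

  casNext casPrev : Addr → (old new : Ptr) → Memory → Memory
  casNext a x y = modify a λ n → record n { next = cas _≟ᴾ_ x y (next n) }
  casPrev a x y = modify a λ n → record n { prev = cas _≟ᴾ_ x y (prev n) }

  casOld : Addr → (old new : Old) → Memory → Memory
  casOld a x y = modify a λ n → record n { old = cas _≟ᴼ_ x y (old n) }

  casNew : Addr → (old new : New) → Memory → Memory
  casNew a x y = modify a λ n → record n { new = cas _≟ᴺ_ x y (new n) }

  casHead : (old new : Ptr × Ptr) → Memory → Memory
  casHead x y m = record m { Head = cas (Product.≡-dec _≟ᴾ_ _≟ᴾ_) x y (Head m) }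

  casA : Fin p → (old new : Announcement) → Memory → Memory
  casA i x y m = record m { A = updateAt (A m) i (cas _≟ᴬ_ x y) }

  data Result : Set where
    found      : Ptr → Result
    notPresent : Result

  -- Control points of MOVE-TO-FRONT(g′) and SEARCH(e).  Each names the next
  -- shared-memory access and carries the live local variables; local
  -- computation is merged into the access preceding it.  A pointer that
  -- the current iteration has already dereferenced, or tested against NULL,
  -- is kept as an Addr.

  data MTFLine : Set where
    testDone   : MTFLine
    readHead   : MTFLine
    readOld    : (h₁ h₂ : Ptr) → MTFLine
    retestDone : (h₁ : Addr) (h₂ : Ptr) → MTFLine
    moveHead   : (h₁ : Addr) (h₂ : Ptr) → MTFLine
    linkNext   : (h₁ : Addr) (h₂ h′ : Ptr) → MTFLine
    linkPrev   : (h₁ : Addr) (h₂ h′ : Ptr) → MTFLine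
    readItem   : (h₁ : Addr) (h′ : Ptr) → MTFLine
    -- In the next three, j ∷ js are the process indices still to be handled.
    readA      : (h₁ : Addr) (h′ : Ptr) (e′ : Item) (j : Fin p) (js : List (Fin p)) → MTFLine
    testOld    : (h₁ : Addr) (h′ : Ptr) (e′ : Item) (j : Fin p) (js : List (Fin p))
                 (ab : Announcement) → MTFLine
    notify     : (h₁ : Addr) (h′ : Ptr) (e′ : Item) (j : Fin p) (js : List (Fin p))
                 (ab : Announcement) → MTFLine
    readPrev   : (h₁ : Addr) (h′ : Ptr) → MTFLine
    readNext   : (h₁ h′ : Addr) (pred : Ptr) → MTFLine
    unlinkNext : (h₁ h′ : Addr) (pred succ : Ptr) → MTFLine
    unlinkPrev : (h₁ h′ : Addr) (pred : Ptr) (succ : Addr) → MTFLine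
    markGone   : (h₁ h′ : Addr) → MTFLine
    markDone   : (h₁ h′ : Addr) → MTFLine

  data Line : Set where
    writeItem writePrev writeNext writeOld writeNew : Line
    announce     : Line
    readHead     : Line
    compareFirst : (h₁ h : Ptr) → Line
    withdraw     : (h₁ : Ptr) → Line
    compareItem  : (h : Addr) (c : ℕ) → Line
    checkAtItem  : (h : Addr) → Line
    setOld       : (h : Addr) → Line
    setNew       : (h : Addr) → Line
    readNew      : (h : Addr) → Line
    moveToFront  : (g′ : Ptr) → MTFLine → Line
    readResult   : Line
    checkPeriod  : (h : Addr) (c : ℕ) → Line
    advance      : (h : Addr) (c : ℕ) → Line
    checkAtEnd   : Line
    -- CAS(A[i], ab, (NULL, ⊥)), then return r.
    clear        : (ab : Announcement) (r : Result) → Line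
    returning    : Result → Line

  forEach : (h₁ : Addr) (h′ : Ptr) (e′ : Item) → List (Fin p) → MTFLine
  forEach h₁ h′ e′ []       = readPrev h₁ h′
  forEach h₁ h′ e′ (j ∷ js) = readA h₁ h′ e′ j js

  afterUnlinkNext : (h₁ h′ : Addr) (pred succ : Ptr) → MTFLine
  afterUnlinkNext h₁ h′ pred nothing     = markGone h₁ h′
  afterUnlinkNext h₁ h′ pred (just succ) = unlinkPrev h₁ h′ pred succ

  while : (h : Ptr) (c : ℕ) → Line
  while nothing  c = checkAtEnd
  while (just h) c = compareItem h c

  -- Dereferencing NULL has no transition, here and in SEARCH.
  data MTFStep (g′ : Addr) : MTFLine → Memory → MTFLine → Memory → Set where
    testDone : ∀ {m} →
      old (heap m g′) ≢ DONE →
      MTFStep g′ testDone m readHead m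
    readHead : ∀ {m h₁ h₂} →
      Head m ≡ (h₁ , h₂) →
      MTFStep g′ readHead m (readOld h₁ h₂) m
    readOld-done : ∀ {m h₁ h₂} →
      old (heap m h₁) ≡ DONE →
      MTFStep g′ (readOld (just h₁) h₂) m (retestDone h₁ h₂) m
    readOld-ptr : ∀ {m h₁ h₂ h′} →
      old (heap m h₁) ≡ ptr h′ →
      MTFStep g′ (readOld (just h₁) h₂) m (linkNext h₁ h₂ h′) m
    retestDone-yes : ∀ {m h₁ h₂} →
      old (heap m g′) ≡ DONE →
      MTFStep g′ (retestDone h₁ h₂) m testDone m
    retestDone-no : ∀ {m h₁ h₂} →
      old (heap m g′) ≢ DONE →
      MTFStep g′ (retestDone h₁ h₂) m (moveHead h₁ h₂) m
    moveHead : ∀ {m h₁ h₂} →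
      MTFStep g′ (moveHead h₁ h₂) m
        testDone (casHead (just h₁ , h₂) (just g′ , just h₁) m)
    linkNext : ∀ {m h₁ h₂ h′} →
      MTFStep g′ (linkNext h₁ h₂ h′) m (linkPrev h₁ h₂ h′) (casNext h₁ nothing h₂ m)
    linkPrev : ∀ {m h₁ h₂ h′} →
      MTFStep g′ (linkPrev h₁ (just h₂) h′) m
        (readItem h₁ h′) (casPrev h₂ nothing (just h₁) m)
    readItem : ∀ {m h₁ h′ e′} →
      item (heap m h₁) ≡ e′ →
      MTFStep g′ (readItem h₁ h′) m (forEach h₁ h′ e′ (allFin p)) m
    readA-same : ∀ {m h₁ h′ e′ j js a} →
      A m j ≡ (a , just e′) →
      MTFStep g′ (readA h₁ h′ e′ j js) m (testOld h₁ h′ e′ j js (a , just e′)) m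
    readA-other : ∀ {m h₁ h′ e′ j js a b} →
      A m j ≡ (a , b) → b ≢ just e′ →
      MTFStep g′ (readA h₁ h′ e′ j js) m (forEach h₁ h′ e′ js) m
    testOld-done : ∀ {m h₁ h′ e′ j js ab} →
      old (heap m h₁) ≡ DONE →
      MTFStep g′ (testOld h₁ h′ e′ j js ab) m (forEach h₁ h′ e′ js) m
    testOld-ptr : ∀ {m h₁ h′ e′ j js ab} →
      old (heap m h₁) ≢ DONE →
      MTFStep g′ (testOld h₁ h′ e′ j js ab) m (notify h₁ h′ e′ j js ab) m
    notify : ∀ {m h₁ h′ e′ j js ab} →
      MTFStep g′ (notify h₁ h′ e′ j js ab) m
        (forEach h₁ h′ e′ js) (casA j ab (just h₁ , nothing) m)
    readPrev : ∀ {m h₁ h′ pred} →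
      prev (heap m h′) ≡ pred →
      MTFStep g′ (readPrev h₁ (just h′)) m (readNext h₁ h′ pred) m
    readNext : ∀ {m h₁ h′ pred succ} →
      next (heap m h′) ≡ succ →
      MTFStep g′ (readNext h₁ h′ pred) m (unlinkNext h₁ h′ pred succ) m
    unlinkNext : ∀ {m h₁ h′ pred succ} →
      MTFStep g′ (unlinkNext h₁ h′ (just pred) succ) m
        (afterUnlinkNext h₁ h′ (just pred) succ) (casNext pred (just h′) succ m)
    unlinkPrev : ∀ {m h₁ h′ pred succ} →
      MTFStep g′ (unlinkPrev h₁ h′ pred succ) m
        (markGone h₁ h′) (casPrev succ (just h′) pred m)
    markGone : ∀ {m h₁ h′} →
      MTFStep g′ (markGone h₁ h′) m
        (markDone h₁ h′) (casNew h′ (ptr (just h₁)) GONE m)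
    markDone : ∀ {m h₁ h′} →
      MTFStep g′ (markDone h₁ h′) m
        testDone (casOld h₁ (ptr (just h′)) DONE m)

  -- The accesses of process i in SEARCH(e), g being the node it allocated.
  data SearchStep (i : Fin p) (e : Item) (g : Addr) :
                  Line → Memory → Line → Memory → Set where
    writeItem : ∀ {m} →
      SearchStep i e g writeItem m writePrev (modify g (λ n → record n { item = e }) m)
    writePrev : ∀ {m} →
      SearchStep i e g writePrev m writeNext (modify g (λ n → record n { prev = nothing }) m)
    writeNext : ∀ {m} →
      SearchStep i e g writeNext m writeOld (modify g (λ n → record n { next = nothing }) m)
    writeOld : ∀ {m} →
      SearchStep i e g writeOld m writeNew (modify g (λ n → record n { old = ptr nothing }) m)
    writeNew : ∀ {m} →
      SearchStep i e g writeNew m announce (modify g (λ n → record n { new = ptr nothing }) m)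
    announce : ∀ {m} →
      SearchStep i e g announce m
        readHead (casA i (nothing , nothing) (just g , just e) m)
    readHead : ∀ {m h₁ h} →
      Head m ≡ (h₁ , h) →
      SearchStep i e g readHead m (compareFirst h₁ h) m
    compareFirst-yes : ∀ {m h₁ h} →
      item (heap m h₁) ≡ e →
      SearchStep i e g (compareFirst (just h₁) h) m (withdraw (just h₁)) m
    compareFirst-no : ∀ {m h₁ h} →
      item (heap m h₁) ≢ e →
      SearchStep i e g (compareFirst (just h₁) h) m (while h 0) m
    withdraw-⊥ : ∀ {m h₁ a} →
      A m i ≡ (a , nothing) →
      SearchStep i e g (withdraw h₁) m
        (clear (a , nothing) (found h₁)) (casA i (just g , just e) (nothing , nothing) m)
    withdraw-item : ∀ {m h₁ a b} →
      A m i ≡ (a , just b) →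
      SearchStep i e g (withdraw h₁) m
        (returning (found h₁)) (casA i (just g , just e) (nothing , nothing) m)
    compareItem-yes : ∀ {m h c} →
      item (heap m h) ≡ e →
      SearchStep i e g (compareItem h c) m (checkAtItem h) m
    compareItem-check : ∀ {m h c} →
      item (heap m h) ≢ e → suc c % φ ≡ 0 →
      SearchStep i e g (compareItem h c) m (checkPeriod h (suc c % φ)) m
    compareItem-skip : ∀ {m h c} →
      item (heap m h) ≢ e → suc c % φ ≢ 0 →
      SearchStep i e g (compareItem h c) m (advance h (suc c % φ)) m
    checkAtItem-⊥ : ∀ {m h a} →
      A m i ≡ (a , nothing) →
      SearchStep i e g (checkAtItem h) m (clear (a , nothing) (found a)) m
    checkAtItem-item : ∀ {m h a b} →
      A m i ≡ (a , just b) →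
      SearchStep i e g (checkAtItem h) m (setOld h) m
    setOld : ∀ {m h} →
      SearchStep i e g (setOld h) m
        (setNew h) (casOld g (ptr nothing) (ptr (just h)) m)
    setNew : ∀ {m h} →
      SearchStep i e g (setNew h) m
        (readNew h) (casNew h (ptr nothing) (ptr (just g)) m)
    readNew-gone : ∀ {m h} →
      new (heap m h) ≡ GONE →
      SearchStep i e g (readNew h) m readResult m
    readNew-ptr : ∀ {m h g′} →
      new (heap m h) ≡ ptr g′ →
      SearchStep i e g (readNew h) m (moveToFront g′ testDone) m
    moveToFront : ∀ {m m′ g′ l l′} →
      MTFStep g′ l m l′ m′ →
      SearchStep i e g (moveToFront (just g′) l) m (moveToFront (just g′) l′) m′
    moveToFront-exit : ∀ {m g′} →
      old (heap m g′) ≡ DONE →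
      SearchStep i e g (moveToFront (just g′) testDone) m readResult m
    readResult : ∀ {m a b} →
      A m i ≡ (a , b) →
      SearchStep i e g readResult m (clear (a , b) (found a)) m
    checkPeriod-⊥ : ∀ {m h c a} →
      A m i ≡ (a , nothing) →
      SearchStep i e g (checkPeriod h c) m (clear (a , nothing) (found a)) m
    checkPeriod-item : ∀ {m h c a b} →
      A m i ≡ (a , just b) →
      SearchStep i e g (checkPeriod h c) m (advance h c) m
    advance : ∀ {m h c h′} →
      next (heap m h) ≡ h′ →
      SearchStep i e g (advance h c) m (while h′ c) m
    checkAtEnd-⊥ : ∀ {m a} →
      A m i ≡ (a , nothing) →
      SearchStep i e g checkAtEnd m (clear (a , nothing) (found a)) m
    checkAtEnd-item : ∀ {m a b} →
      A m i ≡ (a , just b) →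
      SearchStep i e g checkAtEnd m (clear (a , just b) notPresent) m
    clear : ∀ {m ab r} →
      SearchStep i e g (clear ab r) m (returning r) (casA i ab (nothing , nothing) m)

  data ProcState : Set where
    idle       : ProcState
    allocating : (e : Item) → ProcState
    searching  : (e : Item) (g : Addr) → Line → ProcState

  record Config : Set where
    field
      mem  : Memory
      proc : Fin p → ProcState

  open Config public

  data Event : Set where
    invoke : Fin p → Item → Event
    access : Fin p → Event
    return : Fin p → Result → Event
    pause  : Event

  infix 4 _—[_]→_

  data _—[_]→_ (C : Config) : Event → Config → Set where
    invoke : ∀ {i e} →
      proc C i ≡ idle →
      C —[ invoke i e ]→ record C { proc = updateAt (proc C) i (λ _ → allocating e) }
    allocate : ∀ {i e g} →
      proc C i ≡ allocating e → g ∉ allocated (mem C) →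
      C —[ access i ]→ record
        { mem  = record (mem C) { allocated = g ∷ allocated (mem C) }
        ; proc = updateAt (proc C) i (λ _ → searching e g writeItem) }
    access : ∀ {i e g l l′ m′} →
      proc C i ≡ searching e g l → SearchStep i e g l (mem C) l′ m′ →
      C —[ access i ]→ record
        { mem  = m′
        ; proc = updateAt (proc C) i (λ _ → searching e g l′) }
    return : ∀ {i e g r} →
      proc C i ≡ searching e g (returning r) →
      C —[ return i r ]→ record C { proc = updateAt (proc C) i (λ _ → idle) }
    pause : C —[ pause ]→ C

  -- as, preceded by the node x, is linked in both directions and ends in NULL.
  DoublyLinked : (Addr → Node) → (x : Ptr) → (as : List Addr) → Set
  DoublyLinked H x []       = ⊤
  DoublyLinked H x (a ∷ as) =
    prev (H a) ≡ x × next (H a) ≡ head as × DoublyLinked H (just a) as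

  record Initial (C : Config) : Set where
    private
      H = heap (mem C)
    field
      first second : Addr
      others       : List Addr
    nodes : List Addr
    nodes = first ∷ second ∷ others
    field
      nodes-items  : map (λ a → item (H a)) nodes ↭ items
      nodes-linked : DoublyLinked H nothing nodes
      nodes-old    : All (λ a → old (H a) ≡ DONE) nodes
      nodes-new    : All (λ a → new (H a) ≡ ptr nothing) nodes
      allocated≡   : allocated (mem C) ≡ nodes
      Head≡        : Head (mem C) ≡ (just first , just second)
      A≡           : ∀ i → A (mem C) i ≡ (nothing , nothing)
      proc≡        : ∀ i → proc C i ≡ idle

  -- A finite execution is followed by pauses forever; a crashed process
  -- takes no further steps.
  record Execution : Set where
    field
      conf  : ℕ → Config
      event : ℕ → Event
      init  : Initial (conf 0)
      step  : ∀ t → conf t —[ event t ]→ conf (suc t)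

  module _ (E : Execution) where
    open Execution E

    record CompletedSearch : Set where
      field
        process   : Fin p
        argument  : Item
        result    : Result
        start end : ℕ
        start<end : start < end
        invoked   : event start ≡ invoke process argument
        returned  : event end ≡ return process result
        pending   : ∀ t → start < t → t < end → ∀ r → event t ≢ return process r

    module _ (op : CompletedSearch) where
      open CompletedSearch op

      -- The access at l is performed by op in the step from conf t to conf (suc t).
      PerformsAt : Line → ℕ → Set
      PerformsAt l t =
        start < t × t < end × event t ≡ access process ×
        ∃[ g ] proc (conf t) process ≡ searching argument g l

      ReturnsAtFirst : Set
      ReturnsAtFirst = ∃[ t ] ∃[ h₁ ] PerformsAt (withdraw h₁) t

      -- The point t stands for the configuration conf t.  A search linearized
      -- at its own read of Head is linearized in the configuration being read.
      record LinearizedAt (t : ℕ) : Set where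
        field
          after-start : start < t
          before-end  : t ≤ end
          present     : argument ∈ items →
                        ∃[ v ] result ≡ found (just v)
                             × proj₁ (Head (mem (conf t))) ≡ just v
                             × item (heap (mem (conf t)) v) ≡ argument
          absent      : argument ∉ items → result ≡ notPresent
          at-read     : ReturnsAtFirst → PerformsAt readHead t
          announced   : ¬ ReturnsAtFirst → argument ∈ items →
                        ∃[ s ] PerformsAt announce s × s < t

-- The notification of a search is justified by the front node at the time of
-- the preceding test h₁.old ≠ DONE: nodes enter the list only at the front and
-- only once, so a listed node that is not DONE is at the front at that time.
-- It remains to see that a search for an item of the set is notified unless it
-- finds its item at the front.  A node is retired when some process has gone
-- through all announcements on behalf of its replacement; at that time no
-- search for its item remains that is not notified and has already read a
-- Head with another first item.  Next pointers never skip a node that is not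
-- retired, and every item has such a node, so a traversal that is not
-- notified has one with its item still ahead: it cannot reach the end of the
-- list, and the node with its item that it finds is not retired, hence its
-- new field is not GONE and the replacement found there is completed only
-- after the search has been notified.
module Submission where

open import Defs
open import Data.Bool using (if_then_else_)
open import Data.Empty using (⊥; ⊥-elim)
open import Data.Fin using (Fin)
import Data.Fin.Properties as Fin
open import Data.List using (List; []; _∷_; length; map; allFin)
open import Data.List.Membership.Propositional using (_∈_; _∉_)
open import Data.List.Membership.Propositional.Properties using (∈-allFin; ∈-map⁺; ∈-map⁻)
open import Data.List.Relation.Binary.Permutation.Propositional using (↭-sym; ↭⇒↭ₛ)
open import Data.List.Relation.Binary.Permutation.Propositional.Properties using (∈-resp-↭)
open import Data.List.Relation.Binary.Permutation.Setoid.Properties using (Unique-resp-↭)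
import Data.List.Relation.Unary.All as All
open import Data.List.Relation.Unary.AllPairs using (_∷_)
open import Data.List.Relation.Unary.Any using (here; there)
open import Data.List.Relation.Unary.Unique.Propositional using (Unique)
import Data.List.Relation.Unary.Unique.Propositional.Properties as Unique
open import Data.Maybe using (Maybe; just; nothing)
open import Data.Maybe.Properties using (just-injective)
import Data.Maybe.Relation.Unary.All as MaybeAll
import Data.Maybe.Relation.Unary.Any as MaybeAny
open import Data.Nat
  using (ℕ; zero; suc; _≤_; _<_; _≤′_; ≤′-reflexive; ≤′-step; NonZero; s≤s; s≤s⁻¹; z≤n)
import Data.Nat as ℕ
open import Data.Nat.Properties
  using (≤-refl; ≤-trans; <-irrefl; <-trans; <⇒≤; <-≤-trans; m≤n⇒m≤1+n; m≤n⇒m<n∨m≡n;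
         ≰⇒>; <⇒≢; ≤∧≢⇒<; ≤⇒≤′)
open import Data.Product using (Σ-syntax; ∃-syntax; _×_; _,_; proj₁; proj₂)
import Data.Product.Properties as Product
open import Data.Sum using (_⊎_; inj₁; inj₂)
open import Data.Unit using (⊤; tt)
open import Data.Vec.Functional using (updateAt)
open import Data.Vec.Functional.Properties using (updateAt-updates; updateAt-minimal)
open import Function using (_∘_; case_of_)
open import Relation.Binary using (DecidableEquality)
open import Relation.Binary.PropositionalEquality
  using (_≡_; _≢_; refl; sym; trans; cong; subst; subst₂; setoid)
open import Relation.Nullary using (¬_; Dec; yes; no; does)
open import Relation.Nullary.Decidable using (dec-true; dec-false)

import Data.List.Membership.DecPropositional as DecMembership

open DecMembership ℕ._≟_ using (_∈?_)

-- The obstacle is helping: any number of processes carry out the same iteration of MOVE-TO-FRONT at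
-- different speeds, so at each control point a process may assume only what survives every step of
-- the others. Hence the disjunctions "the field still has this value, or the work is finished" and
-- the implications whose premise, an old field other than `DONE`, lapses once some helper has
-- finished. Retirement cannot be read off any field: it takes place between the last notification
-- and the unlinking, when nothing is written, and so it is recorded in a ghost set that only grows.
-- The history of front nodes is the fixed scale on which links and traversals are measured: a
-- listed node keeps its rank while the pointers around it change. Stale CASs on announcements are
-- harmless because the announced pair contains the fresh node of the search, so that a pair which
-- still matches belongs to the search from which it was read.

cas-hit : {X : Set} (_≟_ : DecidableEquality X) {o n x : X} → x ≡ o → cas _≟_ o n x ≡ n
cas-hit _≟_ {o} {n} {x} x≡o rewrite dec-true (x ≟ o) x≡o = refl

cas-miss : {X : Set} (_≟_ : DecidableEquality X) {o n x : X} → x ≢ o → cas _≟_ o n x ≡ x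
cas-miss _≟_ {o} {n} {x} x≢o rewrite dec-false (x ≟ o) x≢o = refl

-- The position counted from the end, so that it is unaffected by consing;
-- 0 outside the list.
rank : List Addr → Addr → ℕ
rank []       x = 0
rank (a ∷ as) x = if does (x ℕ.≟ a) then suc (length as) else rank as x

rank-head : ∀ a as → rank (a ∷ as) a ≡ suc (length as)
rank-head a as rewrite dec-true (a ℕ.≟ a) refl = refl

rank-tail : ∀ {a x} as → x ≢ a → rank (a ∷ as) x ≡ rank as x
rank-tail {a} {x} as x≢a rewrite dec-false (x ℕ.≟ a) x≢a = refl

rank≤length : ∀ as x → rank as x ≤ length as
rank≤length []       x = z≤n
rank≤length (a ∷ as) x with x ℕ.≟ a
... | yes refl rewrite rank-head a as    = ≤-refl
... | no  x≢a  rewrite rank-tail as x≢a = m≤n⇒m≤1+n (rank≤length as x)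

rank-∷ : ∀ a as x → rank as x ≤ rank (a ∷ as) x
rank-∷ a as x with x ℕ.≟ a
... | yes refl rewrite rank-head a as    = m≤n⇒m≤1+n (rank≤length as x)
... | no  x≢a  rewrite rank-tail as x≢a = ≤-refl

rank<head : ∀ {a x} as → x ≢ a → rank (a ∷ as) x < rank (a ∷ as) a
rank<head {a} {x} as x≢a rewrite rank-head a as | rank-tail as x≢a = s≤s (rank≤length as x)

rank≤head : ∀ {a} as x → rank (a ∷ as) x ≤ rank (a ∷ as) a
rank≤head {a} as x rewrite rank-head a as = rank≤length (a ∷ as) x

rank-injective : ∀ {x y} as → x ∈ as → y ∈ as → rank as x ≡ rank as y → x ≡ y
rank-injective {x} {y} (a ∷ as) x∈ y∈ eq with x ℕ.≟ a | y ℕ.≟ a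
... | yes refl | yes refl = refl
... | yes refl | no y≢a   = ⊥-elim (<⇒≢ (rank<head as y≢a) (sym eq))
... | no x≢a   | yes refl = ⊥-elim (<⇒≢ (rank<head as x≢a) eq)
rank-injective {x} {y} (a ∷ as) (here x≡a) y∈ eq | no x≢a | no y≢a = ⊥-elim (x≢a x≡a)
rank-injective {x} {y} (a ∷ as) (there x∈) (here y≡a) eq | no x≢a | no y≢a = ⊥-elim (y≢a y≡a)
rank-injective {x} {y} (a ∷ as) (there x∈) (there y∈) eq | no x≢a | no y≢a =
  rank-injective as x∈ y∈ (trans (sym (rank-tail as x≢a)) (trans eq (rank-tail as y≢a)))

∉⇒≢ : ∀ {x y : Addr} {as} → x ∈ as → y ∉ as → x ≢ y
∉⇒≢ x∈ y∉ refl = y∉ x∈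

Unique-map-injective : ∀ {X Y : Set} (f : X → Y) {xs x y} → Unique (map f xs) →
                       x ∈ xs → y ∈ xs → f x ≡ f y → x ≡ y
Unique-map-injective f u        (here refl) (here refl) eq = refl
Unique-map-injective f (fx∉ ∷ _) (here refl) (there y∈)  eq =
  ⊥-elim (All.lookup fx∉ (∈-map⁺ f y∈) eq)
Unique-map-injective f (fy∉ ∷ _) (there x∈)  (here refl) eq =
  ⊥-elim (All.lookup fy∉ (∈-map⁺ f x∈) (sym eq))
Unique-map-injective f (_ ∷ u)  (there x∈)  (there y∈)  eq = Unique-map-injective f u x∈ y∈ eq

module Correctness (Item : Set) (_≟_ : DecidableEquality Item) (p φ : ℕ) .{{_ : NonZero φ}} (items : List Item) where

  open DMTF Item _≟_ p φ items

  -- Ghost state and the invariant of the shared memory.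

  record Ghost : Set where
    field
      -- The nodes that have been at the front of the list, latest first.
      hist : List Addr
      -- The nodes of hist for which all searches that could still reach
      -- them have been notified; they stay retired.
      ret  : List Addr
      -- The nodes whose allocating search has been announced.
      pub  : List Addr

  open Ghost public

  Settled : Memory → Ghost → Addr → Set
  Settled m G x = x ∈ hist G × old (heap m x) ≡ DONE

  -- A next pointer y from x that may skip nodes, but no node that is not
  -- retired.  The prev pointers need no such condition: unlinking the retired
  -- node h′ replaces a pointer to h′ by its own next pointer, from wherever.
  record GoodLink (m : Memory) (G : Ghost) (x : Addr) (y : Ptr) : Set where
    field
      settled : MaybeAll.All (Settled m G) y
      covers  : ∀ {v} → v ∈ hist G → v ∉ ret G → rank (hist G) v < rank (hist G) x →
                MaybeAny.Any (λ z → rank (hist G) v ≤ rank (hist G) z) y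

  open GoodLink public

  Linked : Memory → Ghost → Addr → Set
  Linked m G x = GoodLink m G x (next (heap m x))

  -- What remains true for a helper that has read `h` from the old field of `x`: the field leaves
  -- this value only for `DONE`, and by then `h` is retired.
  OldIs : Memory → Ghost → Addr → Addr → Set
  OldIs m G x h = old (heap m x) ≡ ptr (just h) ⊎ (old (heap m x) ≡ DONE × h ∈ ret G)

  -- As long as this holds, the list and the new fields of its nodes do not lead to `x`, and only
  -- the owner's CAS can change its old field. It is independent of `pub`, which a node enters
  -- earlier, with the announcement.
  Unpublished : Memory → Ghost → Addr → Set
  Unpublished m G x = x ∉ hist G × (∀ {y} → y ∈ hist G → new (heap m y) ≢ ptr (just x))

  -- The field `newest` is there for the moment at which `f` becomes `DONE`: every older copy of the
  -- item is then `h` or lies behind `h`, which is what `superseded` demands.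
  record Replacing (m : Memory) (G : Ghost) (f h : Addr) : Set where
    field
      old≡      : old (heap m f) ≡ ptr (just h)
      h-settled : Settled m G h
      item≡     : item (heap m h) ≡ item (heap m f)
      new-h     : new (heap m h) ≡ ptr (just f) ⊎ new (heap m h) ≡ GONE
      newest    : ∀ {y} → y ∈ hist G → y ≢ f → item (heap m y) ≡ item (heap m f) →
                  rank (hist G) y ≤ rank (hist G) h

  -- A search reads this field to learn whether its node still counts. `GONE` certifies retirement
  -- and NULL excludes it; a pointer excludes it only while the replacement is unlisted, since a
  -- node is retired before it is marked.
  NewOK : Memory → Ghost → Addr → New → Set
  NewOK m G x (ptr nothing)  = x ∉ ret G
  NewOK m G x (ptr (just g)) =
    g ∈ pub G × item (heap m g) ≡ item (heap m x) × OldIs m G g x × (g ∉ hist G → x ∉ ret G)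
  NewOK m G x GONE           = x ∈ ret G

  -- Between the CAS on `Head` and the one that fills its next field, the front has no usable link;
  -- `linked` tolerates this as long as its old field is not `DONE`. `live-copy` keeps every item
  -- present, while `superseded` leaves at most one settled copy of it unretired. By `unlisted`, an
  -- unlinking CAS that hits a published node outside the list fails.
  record MemInv (m : Memory) (G : Ghost) : Set where
    field
      front second : Addr
      rest         : List Addr
      hist≡        : hist G ≡ front ∷ second ∷ rest
      Head≡        : Head m ≡ (just front , just second)
      hist⊆pub     : ∀ {x} → x ∈ hist G → x ∈ pub G
      pub⊆alloc    : ∀ {x} → x ∈ pub G → x ∈ allocated m
      ret-settled  : ∀ {x} → x ∈ ret G → Settled m G x
      second-done  : old (heap m second) ≡ DONE
      behind-done  : ∀ {x} → x ∈ hist G → x ≢ front → old (heap m x) ≡ DONE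
      front-old    : old (heap m front) ≡ DONE ⊎ ∃[ h ] Replacing m G front h
      item∈items   : ∀ {x} → x ∈ hist G → item (heap m x) ∈ items
      live-copy    : ∀ {e} → e ∈ items →
                     ∃[ v ] v ∈ hist G × v ∉ ret G × item (heap m v) ≡ e
      superseded   : ∀ {x y} → x ∈ hist G → y ∈ hist G → rank (hist G) y < rank (hist G) x →
                     item (heap m x) ≡ item (heap m y) → old (heap m x) ≡ DONE → y ∈ ret G
      new-ok       : ∀ {x} → x ∈ hist G → NewOK m G x (new (heap m x))
      linked       : ∀ {x} → x ∈ hist G →
                     Linked m G x ⊎ (next (heap m x) ≡ nothing × old (heap m x) ≢ DONE)
      unlisted     : ∀ {x} → x ∈ pub G → x ∉ hist G →
                     next (heap m x) ≡ nothing × new (heap m x) ≡ ptr nothing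

    front∈ : front ∈ hist G
    front∈ = subst (front ∈_) (sym hist≡) (here refl)

    second∈ : second ∈ hist G
    second∈ = subst (second ∈_) (sym hist≡) (there (here refl))

    undone⇒front : ∀ {x} → x ∈ hist G → old (heap m x) ≢ DONE → x ≡ front
    undone⇒front {x} x∈ ¬done with x ℕ.≟ front
    ... | yes x≡front = x≡front
    ... | no  x≢front = ⊥-elim (¬done (behind-done x∈ x≢front))

    undone-replacing : ∀ {x} → x ∈ hist G → old (heap m x) ≢ DONE →
                       ∃[ h ] Replacing m G x h
    undone-replacing x∈ ¬done with undone⇒front x∈ ¬done | front-old
    ... | refl | inj₁ done = ⊥-elim (¬done done)
    ... | refl | inj₂ r    = r

    old≢NULL : ∀ {x} → x ∈ hist G → old (heap m x) ≢ ptr nothing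
    old≢NULL {x} x∈ eq with undone-replacing x∈ (λ done → case trans (sym eq) done of λ ())
    ... | h , r = case trans (sym eq) (Replacing.old≡ r) of λ ()

  -- What a step guarantees to the other processes.

  Grows : (m : Memory) (G : Ghost) (m′ : Memory) (G′ : Ghost) → Set
  Grows m G m′ G′ = ∃[ y ] hist G′ ≡ y ∷ hist G × y ∉ hist G × proj₁ (Head m′) ≡ just y
                         × ∃[ h ] h ∈ hist G × new (heap m h) ≡ ptr (just y)

  -- What a step guarantees to the processes that own none of the nodes in N.
  record Evolves (N : Addr → Set) (m : Memory) (G : Ghost) (m′ : Memory) (G′ : Ghost) : Set where
    field
      alloc⊆    : ∀ {x} → x ∈ allocated m → x ∈ allocated m′
      pub⊆      : ∀ {x} → x ∈ pub G → x ∈ pub G′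
      ret⊆      : ∀ {x} → x ∈ ret G → x ∈ ret G′
      hist-step : (hist G′ ≡ hist G × Head m′ ≡ Head m) ⊎ Grows m G m′ G′
      item≡     : ∀ {x} → x ∈ pub G → item (heap m′ x) ≡ item (heap m x)
      done      : ∀ {x} → x ∈ hist G → old (heap m x) ≡ DONE → old (heap m′ x) ≡ DONE
      old-is    : ∀ {x h} → x ∈ pub G → OldIs m G x h → OldIs m′ G′ x h
      new-ptr   : ∀ {x g} → x ∈ hist G → new (heap m x) ≡ ptr (just g) →
                  new (heap m′ x) ≡ ptr (just g) ⊎ (new (heap m′ x) ≡ GONE × g ∈ hist G)
      new-gone  : ∀ {x} → x ∈ hist G → new (heap m x) ≡ GONE → new (heap m′ x) ≡ GONE
      link      : ∀ {x} → x ∈ hist G → Linked m G x → Linked m′ G′ x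
      goodLink  : ∀ {x y} → x ∈ hist G → GoodLink m G x y → GoodLink m′ G′ x y
      private-  : ∀ {x} → ¬ N x → x ∈ allocated m → x ∉ pub G →
                  x ∉ pub G′ × item (heap m′ x) ≡ item (heap m x) × old (heap m′ x) ≡ old (heap m x)
                  × new (heap m′ x) ≡ new (heap m x)
                  × (next (heap m x) ≡ nothing → next (heap m′ x) ≡ nothing)
      unpub     : ∀ {x} → ¬ N x → x ∈ pub G → Unpublished m G x →
                  Unpublished m′ G′ x × old (heap m′ x) ≡ old (heap m x)

    hist⊆ : ∀ {x} → x ∈ hist G → x ∈ hist G′
    hist⊆ {x} x∈ with hist-step
    ... | inj₁ (eq , _)     = subst (x ∈_) (sym eq) x∈
    ... | inj₂ (y , eq , _) = subst (x ∈_) (sym eq) (there x∈)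

    rank≡ : ∀ {x} → x ∈ hist G → rank (hist G′) x ≡ rank (hist G) x
    rank≡ {x} x∈ with hist-step
    ... | inj₁ (eq , _)           = cong (λ as → rank as x) eq
    ... | inj₂ (y , eq , y∉ , _) =
      trans (cong (λ as → rank as x) eq) (rank-tail (hist G) (∉⇒≢ x∈ y∉))

    settled⊆ : ∀ {x} → Settled m G x → Settled m′ G′ x
    settled⊆ (x∈ , d) = hist⊆ x∈ , done x∈ d

  -- Memory steps that leave `Head` and the ghost state unchanged.

  data OldStep (N : Addr → Set) (m : Memory) (G : Ghost) (x : Addr) (o : Old) : Set where
    same   : o ≡ old (heap m x) → OldStep N m G x o
    finish : ∀ {h} → o ≡ DONE → x ∈ hist G → old (heap m x) ≡ ptr (just h) → h ∈ ret G →
             Linked m G x → OldStep N m G x o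
    set    : ∀ {h} → o ≡ ptr (just h) → N x → old (heap m x) ≡ ptr nothing →
             Unpublished m G x → OldStep N m G x o

  data NewStep (N : Addr → Set) (m : Memory) (G : Ghost) (x : Addr) (n : New) : Set where
    same    : n ≡ new (heap m x) → NewStep N m G x n
    publish : ∀ {g} → n ≡ ptr (just g) → x ∈ hist G → new (heap m x) ≡ ptr nothing →
              N g → g ∈ pub G → g ∉ hist G → item (heap m g) ≡ item (heap m x) →
              old (heap m g) ≡ ptr (just x) → NewStep N m G x n
    vanish  : ∀ {g} → n ≡ GONE → new (heap m x) ≡ ptr (just g) → g ∈ hist G → x ∈ ret G →
              NewStep N m G x n

  record NodeStep (N : Addr → Set) (m : Memory) (G : Ghost) (x : Addr) (n : Node) : Set where
    field
      item-step : item n ≡ item (heap m x)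
      next-step : next n ≡ next (heap m x) ⊎ (x ∈ hist G × GoodLink m G x (next n))
      old-step  : OldStep N m G x (old n)
      new-step  : NewStep N m G x (new n)

  -- The target of the unlinking CAS on a next field comes from a prev field, about which nothing is
  -- known, so it may be any address, even a node still being initialized. The CAS expects a
  -- non-NULL value; hence a next field already set to NULL survives, and before that its value is
  -- irrelevant.
  record PrivateStep (n n′ : Node) : Set where
    field
      item≡ : item n′ ≡ item n
      old≡  : old n′ ≡ old n
      new≡  : new n′ ≡ new n
      next≡ : next n ≡ nothing → next n′ ≡ nothing

  record HeapStep (N : Addr → Set) (m : Memory) (G : Ghost) (m′ : Memory) : Set where
    field
      Head≡  : Head m′ ≡ Head m
      alloc⊆ : ∀ {x} → x ∈ allocated m → x ∈ allocated m′
      pub-   : ∀ {x} → x ∈ pub G → NodeStep N m G x (heap m′ x)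
      priv-  : ∀ {x} → ¬ N x → x ∈ allocated m → x ∉ pub G → PrivateStep (heap m x) (heap m′ x)

  same-node : ∀ {N m G x} → NodeStep N m G x (heap m x)
  same-node = record { item-step = refl ; next-step = inj₁ refl ; old-step = same refl ; new-step = same refl }

  same-private : ∀ {n} → PrivateStep n n
  same-private = record { item≡ = refl ; old≡ = refl ; new≡ = refl ; next≡ = λ eq → eq }

  heap-same : ∀ {N m G m′} → heap m′ ≡ heap m → Head m′ ≡ Head m →
              (∀ {x} → x ∈ allocated m → x ∈ allocated m′) → HeapStep N m G m′
  heap-same {N} {m} {G} refl Head≡ alloc⊆ = record
    { Head≡ = Head≡ ; alloc⊆ = alloc⊆
    ; pub- = λ _ → same-node {N} {m} {G} ; priv- = λ _ _ _ → same-private }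

  modify-step : ∀ {N m G} a f →
    (a ∈ pub G → NodeStep N m G a (f (heap m a))) →
    (¬ N a → a ∉ pub G → PrivateStep (heap m a) (f (heap m a))) →
    HeapStep N m G (modify a f m)
  modify-step {N} {m} {G} a f on-pub on-priv = record
    { Head≡ = refl ; alloc⊆ = λ x∈ → x∈ ; pub- = go-pub ; priv- = go-priv }
    where
    go-pub : ∀ {x} → x ∈ pub G → NodeStep N m G x (heap (modify a f m) x)
    go-pub {x} x∈ with x ℕ.≟ a
    ... | yes refl rewrite dec-true (x ℕ.≟ x) refl = on-pub x∈
    ... | no  x≢a  rewrite dec-false (x ℕ.≟ a) x≢a = same-node {N} {m} {G}
    go-priv : ∀ {x} → ¬ N x → x ∈ allocated m → x ∉ pub G →
              PrivateStep (heap m x) (heap (modify a f m) x)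
    go-priv {x} ¬N _ x∉ with x ℕ.≟ a
    ... | yes refl rewrite dec-true (x ℕ.≟ x) refl = on-priv ¬N x∉
    ... | no  x≢a  rewrite dec-false (x ℕ.≟ a) x≢a = same-private

  modify-hit : ∀ {a f m} → heap (modify a f m) a ≡ f (heap m a)
  modify-hit {a} rewrite dec-true (a ℕ.≟ a) refl = refl

  module _ {N : Addr → Set} {m m′ : Memory} {G : Ghost} (inv : MemInv m G) (step : HeapStep N m G m′) where
    open MemInv inv
    private module S = HeapStep step
    private module NS {x} (x∈ : x ∈ pub G) = NodeStep (S.pub- x∈)

    private
      hs-done : ∀ {x} → x ∈ hist G → old (heap m x) ≡ DONE → old (heap m′ x) ≡ DONE
      hs-done x∈ d with NS.old-step (hist⊆pub x∈)
      ... | same eq            = trans eq d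
      ... | finish eq _ _ _ _  = eq
      ... | set _ _ o _        = case trans (sym o) d of λ ()

      hs-goodLink : ∀ {x y} → GoodLink m G x y → GoodLink m′ G x y
      hs-goodLink gl = record
        { settled = MaybeAll.map (λ (z∈ , d) → z∈ , hs-done z∈ d) (settled gl)
        ; covers  = covers gl }

      hs-link : ∀ {x} → x ∈ hist G → Linked m G x → Linked m′ G x
      hs-link x∈ l with NS.next-step (hist⊆pub x∈)
      ... | inj₁ eq       = subst (GoodLink m′ G _) (sym eq) (hs-goodLink l)
      ... | inj₂ (_ , gl) = hs-goodLink gl

      hs-new-ptr : ∀ {x g} → x ∈ hist G → new (heap m x) ≡ ptr (just g) →
                   new (heap m′ x) ≡ ptr (just g) ⊎ (new (heap m′ x) ≡ GONE × g ∈ hist G)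
      hs-new-ptr x∈ eq with NS.new-step (hist⊆pub x∈)
      ... | same eq′ = inj₁ (trans eq′ eq)
      ... | publish _ _ eq′ _ _ _ _ _ = case trans (sym eq) eq′ of λ ()
      ... | vanish eq′ eq″ g∈ _ with trans (sym eq) eq″
      ...   | refl = inj₂ (eq′ , g∈)

      hs-new-gone : ∀ {x} → x ∈ hist G → new (heap m x) ≡ GONE → new (heap m′ x) ≡ GONE
      hs-new-gone x∈ eq with NS.new-step (hist⊆pub x∈)
      ... | same eq′ = trans eq′ eq
      ... | publish _ _ eq′ _ _ _ _ _ = case trans (sym eq) eq′ of λ ()
      ... | vanish eq′ _ _ _ = eq′

      hs-old-is : ∀ {x h} → x ∈ pub G → OldIs m G x h → OldIs m′ G x h
      hs-old-is x∈ (inj₁ eq) with NS.old-step x∈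
      ... | same eq′ = inj₁ (trans eq′ eq)
      ... | finish d _ eq′ h∈ _ with trans (sym eq) eq′
      ...   | refl = inj₂ (d , h∈)
      hs-old-is x∈ (inj₁ eq) | set _ _ eq′ _ = case trans (sym eq) eq′ of λ ()
      hs-old-is x∈ (inj₂ (d , h∈)) with NS.old-step x∈
      ... | same eq′            = inj₂ (trans eq′ d , h∈)
      ... | finish d′ _ _ _ _   = inj₂ (d′ , h∈)
      ... | set _ _ eq′ _       = case trans (sym d) eq′ of λ ()

    heapStep-inv : MemInv m′ G
    heapStep-inv = record
      { front = front ; second = second ; rest = rest ; hist≡ = hist≡
      ; Head≡ = trans S.Head≡ Head≡
      ; hist⊆pub = hist⊆pub
      ; pub⊆alloc = λ x∈ → S.alloc⊆ (pub⊆alloc x∈)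
      ; ret-settled = λ x∈ → let (x∈h , d) = ret-settled x∈ in x∈h , hs-done x∈h d
      ; second-done = hs-done second∈ second-done
      ; behind-done = λ x∈ x≢ → hs-done x∈ (behind-done x∈ x≢)
      ; front-old = front-old′
      ; item∈items = λ x∈ → subst (_∈ items) (sym (NS.item-step (hist⊆pub x∈))) (item∈items x∈)
      ; live-copy = λ e∈ → let (v , v∈ , v∉ , eq) = live-copy e∈ in
          v , v∈ , v∉ , trans (NS.item-step (hist⊆pub v∈)) eq
      ; superseded = λ {x} {y} x∈ y∈ r eq → superseded′ x∈ y∈ r
          (trans (sym (NS.item-step (hist⊆pub x∈))) (trans eq (NS.item-step (hist⊆pub y∈))))
      ; new-ok = new-ok′
      ; linked = linked′
      ; unlisted = unlisted′ }
      where
      front-old′ : old (heap m′ front) ≡ DONE ⊎ ∃[ h ] Replacing m′ G front h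
      front-old′ with front-old
      ... | inj₁ d = inj₁ (hs-done front∈ d)
      ... | inj₂ (h , r) with NS.old-step (hist⊆pub front∈)
      ...   | finish eq _ _ _ _ = inj₁ eq
      ...   | set _ _ eq _ = ⊥-elim (old≢NULL front∈ eq)
      ...   | same eq = inj₂ (h , record
        { old≡ = trans eq R.old≡
        ; h-settled = proj₁ R.h-settled , hs-done (proj₁ R.h-settled) (proj₂ R.h-settled)
        ; item≡ = trans (NS.item-step h∈) (trans R.item≡ (sym (NS.item-step f∈)))
        ; new-h = new-h′ R.new-h
        ; newest = λ y∈ y≢ eq → R.newest y∈ y≢
            (trans (sym (NS.item-step (hist⊆pub y∈))) (trans eq (NS.item-step f∈))) })
        where
        module R = Replacing r
        f∈ = hist⊆pub front∈
        h∈ = hist⊆pub (proj₁ R.h-settled)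
        new-h′ : new (heap m h) ≡ ptr (just front) ⊎ new (heap m h) ≡ GONE →
                 new (heap m′ h) ≡ ptr (just front) ⊎ new (heap m′ h) ≡ GONE
        new-h′ (inj₁ eq) with hs-new-ptr (proj₁ R.h-settled) eq
        ... | inj₁ eq′ = inj₁ eq′
        ... | inj₂ (eq′ , _) = inj₂ eq′
        new-h′ (inj₂ eq) = inj₂ (hs-new-gone (proj₁ R.h-settled) eq)

      superseded′ : ∀ {x y} → x ∈ hist G → y ∈ hist G → rank (hist G) y < rank (hist G) x →
                    item (heap m x) ≡ item (heap m y) → old (heap m′ x) ≡ DONE → y ∈ ret G
      superseded′ {x} {y} x∈ y∈ y<x eq d with NS.old-step (hist⊆pub x∈)
      ... | same eq′ = superseded x∈ y∈ y<x eq (trans (sym eq′) d)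
      ... | set eq′ _ _ _ = case trans (sym eq′) d of λ ()
      -- Here `x` is the front and the replacement of `h` is completed. By `newest`, the older copy
      -- `y` is `h`, retired by assumption, or lies behind `h`, which is itself `DONE` and
      -- supersedes it.
      ... | finish {h} _ _ o h∈ _
          with undone⇒front x∈ (λ d → case trans (sym o) d of λ ())
             | undone-replacing x∈ (λ d → case trans (sym o) d of λ ())
      ...   | refl | h′ , r with trans (sym o) (Replacing.old≡ r)
      ...     | refl with y ℕ.≟ h
      ...       | yes refl = h∈
      ...       | no y≢h = superseded (proj₁ R.h-settled) y∈
                  (≤∧≢⇒< (R.newest y∈ y≢x (sym eq)) (λ r≡ → y≢h (rank-injective _ y∈ (proj₁ R.h-settled) r≡)))
                  (trans R.item≡ eq) (proj₂ R.h-settled)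
        where
        module R = Replacing r
        y≢x : y ≢ x
        y≢x refl = <-irrefl refl y<x

      new-ok′ : ∀ {x} → x ∈ hist G → NewOK m′ G x (new (heap m′ x))
      new-ok′ {x} x∈ with NS.new-step (hist⊆pub x∈)
      ... | vanish eq _ _ x∈r = subst (NewOK m′ G x) (sym eq) x∈r
      ... | publish {g} eq _ n _ g∈ g∉ i o = subst (NewOK m′ G x) (sym eq)
            ( g∈ , trans (NS.item-step g∈) (trans i (sym (NS.item-step (hist⊆pub x∈))))
            , hs-old-is g∈ (inj₁ o) , λ _ → subst (NewOK m G x) n (new-ok x∈))
      ... | same eq rewrite eq = go (new (heap m x)) (new-ok x∈)
        where
        go : ∀ n → NewOK m G x n → NewOK m′ G x n
        go (ptr nothing)  ok = ok
        go (ptr (just g)) (g∈ , i , o , l) =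
          g∈ , trans (NS.item-step g∈) (trans i (sym (NS.item-step (hist⊆pub x∈)))) , hs-old-is g∈ o , l
        go GONE ok = ok

      linked′ : ∀ {x} → x ∈ hist G →
                Linked m′ G x ⊎ (next (heap m′ x) ≡ nothing × old (heap m′ x) ≢ DONE)
      linked′ {x} x∈ with linked x∈ | NS.next-step (hist⊆pub x∈) | NS.old-step (hist⊆pub x∈)
      ... | inj₁ l | _ | _ = inj₁ (hs-link x∈ l)
      ... | inj₂ _ | inj₂ (_ , gl) | _ = inj₁ (hs-goodLink gl)
      ... | inj₂ _ | inj₁ _ | finish _ _ _ _ l = inj₁ (hs-link x∈ l)
      ... | inj₂ _ | inj₁ _ | set _ _ o _ = ⊥-elim (old≢NULL x∈ o)
      ... | inj₂ (n , o) | inj₁ eq | same eq′ = inj₂ (trans eq n , λ d → o (trans (sym eq′) d))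

      unlisted′ : ∀ {x} → x ∈ pub G → x ∉ hist G →
                  next (heap m′ x) ≡ nothing × new (heap m′ x) ≡ ptr nothing
      unlisted′ {x} x∈ x∉ with unlisted x∈ x∉ | NS.next-step x∈ | NS.new-step x∈
      ... | _ | inj₂ (x∈h , _) | _ = ⊥-elim (x∉ x∈h)
      ... | _ | inj₁ _ | publish _ x∈h _ _ _ _ _ _ = ⊥-elim (x∉ x∈h)
      ... | _ | inj₁ _ | vanish _ _ _ x∈r = ⊥-elim (x∉ (proj₁ (ret-settled x∈r)))
      ... | n , w | inj₁ eq | same eq′ = trans eq n , trans eq′ w

    heapStep-evolves : Evolves N m G m′ G
    heapStep-evolves = record
      { alloc⊆ = S.alloc⊆ ; pub⊆ = λ x∈ → x∈ ; ret⊆ = λ x∈ → x∈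
      ; hist-step = inj₁ (refl , S.Head≡)
      ; item≡ = NS.item-step
      ; done = hs-done ; old-is = hs-old-is ; new-ptr = hs-new-ptr ; new-gone = hs-new-gone
      ; link = hs-link ; goodLink = λ _ → hs-goodLink
      ; private- = λ ¬N x∈ x∉ → let module P = PrivateStep (S.priv- ¬N x∈ x∉) in
          x∉ , P.item≡ , P.old≡ , P.new≡ , P.next≡
      ; unpub = unpub′ }
      where
      unpub′ : ∀ {x} → ¬ N x → x ∈ pub G → Unpublished m G x →
               Unpublished m′ G x × old (heap m′ x) ≡ old (heap m x)
      unpub′ {x} ¬N x∈ (x∉ , u) = (x∉ , u′) , old≡
        where
        u′ : ∀ {y} → y ∈ hist G → new (heap m′ y) ≢ ptr (just x)
        u′ y∈ eq with NS.new-step (hist⊆pub y∈)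
        ... | same eq′ = u y∈ (trans (sym eq′) eq)
        ... | vanish eq′ _ _ _ = case trans (sym eq′) eq of λ ()
        ... | publish eq′ _ _ Ng _ _ _ _ with trans (sym eq′) eq
        ...   | refl = ¬N Ng
        old≡ : old (heap m′ x) ≡ old (heap m x)
        old≡ with NS.old-step x∈
        ... | same eq = eq
        ... | finish _ x∈h _ _ _ = ⊥-elim (x∉ x∈h)
        ... | set _ Nx _ _ = ⊥-elim (¬N Nx)

  -- The steps that change the ghost state: move to front, retirement, announcement.

  module _ {m : Memory} {G : Ghost} (inv : MemInv m G) where
    open MemInv inv

    -- No listed node ranks strictly between the two components of `Head`. This serves the helper
    -- that fills the next field of the front as well as the search that starts its traversal at the
    -- second node.
    second-link : GoodLink m G front (just second)
    second-link = record
      { settled = MaybeAll.just (second∈ , second-done)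
      ; covers  = λ {v} v∈ _ v<f → MaybeAny.just (below v v∈ v<f) }
      where
      below : ∀ v → v ∈ hist G → rank (hist G) v < rank (hist G) front →
              rank (hist G) v ≤ rank (hist G) second
      below v v∈ v<f rewrite hist≡ =
        subst (_≤ _) (sym (rank-tail (second ∷ rest) λ { refl → <-irrefl refl v<f }))
          (≤-trans (rank≤head rest v) (rank-∷ front (second ∷ rest) second))

    -- A front that is `DONE` makes every listed node `DONE`, so no replacement is under way when
    -- `g` enters, and the new front becomes the only undone node.
    module Push {N : Addr → Set} {hd : Ptr × Ptr} {g h : Addr} (hd≡ : hd ≡ (just g , just front))
                (front-done : old (heap m front) ≡ DONE)
                (g∉ : g ∉ hist G) (h∈ : h ∈ hist G) (new≡ : new (heap m h) ≡ ptr (just g)) where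

      private
        ok : NewOK m G h (ptr (just g))
        ok = subst (NewOK m G h) new≡ (new-ok h∈)

        g∈pub = proj₁ ok

        h∉ret : h ∉ ret G
        h∉ret = proj₂ (proj₂ (proj₂ ok)) g∉

        old-g : old (heap m g) ≡ ptr (just h)
        old-g with proj₁ (proj₂ (proj₂ ok))
        ... | inj₁ eq       = eq
        ... | inj₂ (_ , h∈r) = ⊥-elim (h∉ret h∈r)

        all-done : ∀ {x} → x ∈ hist G → old (heap m x) ≡ DONE
        all-done {x} x∈ with x ℕ.≟ front
        ... | yes refl = front-done
        ... | no  x≢   = behind-done x∈ x≢

        m′ : Memory
        m′ = record m { Head = hd }

      G′ : Ghost
      G′ = record G { hist = g ∷ hist G }

      private
        rank≡ : ∀ {x} → x ∈ hist G → rank (hist G′) x ≡ rank (hist G) x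
        rank≡ x∈ = rank-tail (hist G) (∉⇒≢ x∈ g∉)

        rank-mono : ∀ {x y} → x ∈ hist G → y ∈ hist G →
                    rank (hist G) x ≤ rank (hist G) y → rank (hist G′) x ≤ rank (hist G′) y
        rank-mono x∈ y∈ = subst₂ _≤_ (sym (rank≡ x∈)) (sym (rank≡ y∈))

        below-old : ∀ {x y} → y ∈ hist G → x ∈ hist G′ → rank (hist G′) x < rank (hist G′) y →
                    x ∈ hist G × rank (hist G) x < rank (hist G) y
        below-old y∈ (here refl) x<y = ⊥-elim (<-irrefl refl (<-≤-trans x<y (rank≤head (hist G) _)))
        below-old y∈ (there x∈) x<y = x∈ , subst₂ _<_ (rank≡ x∈) (rank≡ y∈) x<y

        goodLink′ : ∀ {x y} → x ∈ hist G → GoodLink m G x y → GoodLink m′ G′ x y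
        goodLink′ {y = y} x∈ gl = record
          { settled = MaybeAll.map (λ (z∈ , d) → there z∈ , d) (settled gl)
          ; covers  = λ v∈ v∉ v<x → let (v∈′ , v<x′) = below-old x∈ v∈ v<x in
              lift (settled gl) v∈′ (covers gl v∈′ v∉ v<x′) }
          where
          lift : ∀ {v y} → MaybeAll.All (Settled m G) y → v ∈ hist G →
                 MaybeAny.Any (λ z → rank (hist G) v ≤ rank (hist G) z) y →
                 MaybeAny.Any (λ z → rank (hist G′) v ≤ rank (hist G′) z) y
          lift (MaybeAll.just (z∈ , _)) v∈ (MaybeAny.just v≤z) = MaybeAny.just (rank-mono v∈ z∈ v≤z)

      push-inv : MemInv m′ G′
      push-inv = record
        { front = g ; second = front ; rest = second ∷ rest
        ; hist≡ = cong (g ∷_) hist≡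
        ; Head≡ = hd≡
        ; hist⊆pub = λ { (here refl) → g∈pub ; (there x∈) → hist⊆pub x∈ }
        ; pub⊆alloc = pub⊆alloc
        ; ret-settled = λ x∈ → let (x∈h , d) = ret-settled x∈ in there x∈h , d
        ; second-done = front-done
        ; behind-done = λ { (here refl) x≢ → ⊥-elim (x≢ refl) ; (there x∈) _ → all-done x∈ }
        ; front-old = inj₂ (h , record
          { old≡ = old-g
          ; h-settled = there h∈ , all-done h∈
          ; item≡ = sym (proj₁ (proj₂ ok))
          ; new-h = inj₁ new≡
          ; newest = newest′ })
        ; item∈items = λ { (here refl) → subst (_∈ items) (sym (proj₁ (proj₂ ok))) (item∈items h∈)
                         ; (there x∈) → item∈items x∈ }
        ; live-copy = λ e∈ → let (v , v∈ , r) = live-copy e∈ in v , there v∈ , r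
        ; superseded = superseded′
        ; new-ok = new-ok′
        ; linked = linked′
        ; unlisted = λ x∈ x∉ → unlisted x∈ (x∉ ∘ there) }
        where
        newest′ : ∀ {y} → y ∈ hist G′ → y ≢ g → item (heap m y) ≡ item (heap m g) →
                  rank (hist G′) y ≤ rank (hist G′) h
        newest′ (here refl) y≢ _ = ⊥-elim (y≢ refl)
        newest′ {y} (there y∈) _ eq with rank (hist G) y ℕ.≤? rank (hist G) h
        ... | yes y≤h = rank-mono y∈ h∈ y≤h
        -- A copy in front of `h` is `DONE`, like every listed node at this moment, and would have
        -- superseded `h`; but `h` cannot be retired while its replacement `g` is unlisted.
        ... | no  y≰h = ⊥-elim (h∉ret (superseded y∈ h∈ (≰⇒> y≰h)
                          (trans eq (proj₁ (proj₂ ok))) (all-done y∈)))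

        superseded′ : ∀ {x y} → x ∈ hist G′ → y ∈ hist G′ → rank (hist G′) y < rank (hist G′) x →
                      item (heap m x) ≡ item (heap m y) → old (heap m x) ≡ DONE → y ∈ ret G
        superseded′ (here refl) _ _ _ d = case trans (sym old-g) d of λ ()
        superseded′ (there x∈) y∈ y<x eq d =
          let (y∈′ , y<x′) = below-old x∈ y∈ y<x in superseded x∈ y∈′ y<x′ eq d

        new-ok′ : ∀ {x} → x ∈ hist G′ → NewOK m′ G′ x (new (heap m x))
        new-ok′ (here refl) = subst (NewOK m′ G′ g) (sym (proj₂ (unlisted g∈pub g∉)))
          λ g∈r → g∉ (proj₁ (ret-settled g∈r))
        new-ok′ {x} (there x∈) = go (new (heap m x)) (new-ok x∈)
          where
          go : ∀ n → NewOK m G x n → NewOK m′ G′ x n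
          go (ptr nothing)  ok = ok
          go (ptr (just y)) (y∈ , i , o , l) = y∈ , i , o , λ y∉ → l (y∉ ∘ there)
          go GONE ok = ok

        linked′ : ∀ {x} → x ∈ hist G′ →
                  Linked m′ G′ x ⊎ (next (heap m x) ≡ nothing × old (heap m x) ≢ DONE)
        linked′ (here refl) = inj₂ (proj₁ (unlisted g∈pub g∉) , λ d → case trans (sym old-g) d of λ ())
        linked′ (there x∈) with linked x∈
        ... | inj₁ l = inj₁ (goodLink′ x∈ l)
        ... | inj₂ r = inj₂ r

      push-evolves : Evolves N m G m′ G′
      push-evolves = record
        { alloc⊆ = λ x∈ → x∈ ; pub⊆ = λ x∈ → x∈ ; ret⊆ = λ x∈ → x∈
        ; hist-step = inj₂ (g , refl , g∉ , cong proj₁ hd≡ , h , h∈ , new≡)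
        ; item≡ = λ _ → refl
        ; done = λ _ d → d ; old-is = λ _ o → o
        ; new-ptr = λ _ eq → inj₁ eq ; new-gone = λ _ eq → eq
        ; link = goodLink′ ; goodLink = goodLink′
        ; private- = λ _ _ x∉ → x∉ , refl , refl , refl , λ eq → eq
        ; unpub = λ _ _ (x∉ , u) → (unlisted′ x∉ u , unpub′ x∉ u) , refl }
        where
        unlisted′ : ∀ {x} → x ∉ hist G → (∀ {y} → y ∈ hist G → new (heap m y) ≢ ptr (just x)) →
                    x ∉ hist G′
        unlisted′ x∉ u (here refl) = u h∈ new≡
        unlisted′ x∉ u (there x∈)  = x∉ x∈
        unpub′ : ∀ {x} → x ∉ hist G → (∀ {y} → y ∈ hist G → new (heap m y) ≢ ptr (just x)) →
                 ∀ {y} → y ∈ hist G′ → new (heap m y) ≢ ptr (just x)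
        unpub′ x∉ u (here refl) eq = case trans (sym (proj₂ (unlisted g∈pub g∉))) eq of λ ()
        unpub′ x∉ u (there y∈)  eq = u y∈ eq

    -- A pure ghost step. The copy `f` takes over as the live one of its item, and `new-h` ensures
    -- that the new field of `h` already admits the retirement: it is `GONE` or names `f`, which is
    -- listed.
    module Retire {N : Addr → Set} {f h : Addr} (f∈ : f ∈ hist G)
                  (old-f : old (heap m f) ≡ ptr (just h)) where

      private
        undone : old (heap m f) ≢ DONE
        undone d = case trans (sym old-f) d of λ ()

        replacing : Replacing m G f h
        replacing with undone-replacing f∈ undone
        ... | h′ , r with trans (sym old-f) (Replacing.old≡ r)
        ...   | refl = r

        module R = Replacing replacing
        h∈ = proj₁ R.h-settled

        h≢f : h ≢ f
        h≢f refl = undone (proj₂ R.h-settled)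

      replaced-item : item (heap m h) ≡ item (heap m f)
      replaced-item = R.item≡

      G′ : Ghost
      G′ = record G { ret = h ∷ ret G }

      private
        f∉ret : f ∉ ret G′
        f∉ret (here refl) = h≢f refl
        f∉ret (there f∈r) = undone (proj₂ (ret-settled f∈r))

        goodLink′ : ∀ {x y} → GoodLink m G x y → GoodLink m G′ x y
        goodLink′ gl = record { settled = settled gl ; covers = λ v∈ v∉ → covers gl v∈ (v∉ ∘ there) }

        old-is′ : ∀ {x y} → OldIs m G x y → OldIs m G′ x y
        old-is′ (inj₁ eq) = inj₁ eq
        old-is′ (inj₂ (d , y∈)) = inj₂ (d , there y∈)

      retire-inv : MemInv m G′
      retire-inv = record
        { front = front ; second = second ; rest = rest ; hist≡ = hist≡ ; Head≡ = Head≡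
        ; hist⊆pub = hist⊆pub ; pub⊆alloc = pub⊆alloc
        ; ret-settled = λ { (here refl) → R.h-settled ; (there x∈) → ret-settled x∈ }
        ; second-done = second-done
        ; behind-done = behind-done
        ; front-old = front-old′
        ; item∈items = item∈items
        ; live-copy = live-copy′
        ; superseded = λ x∈ y∈ y<x eq d → there (superseded x∈ y∈ y<x eq d)
        ; new-ok = λ {x} x∈ → new-ok′ x∈ _ refl (new-ok x∈)
        ; linked = linked′
        ; unlisted = unlisted }
        where
        front-old′ : old (heap m front) ≡ DONE ⊎ ∃[ h ] Replacing m G′ front h
        front-old′ with front-old
        ... | inj₁ d = inj₁ d
        ... | inj₂ (y , r) = inj₂ (y , record
          { old≡ = Replacing.old≡ r ; h-settled = Replacing.h-settled r ; item≡ = Replacing.item≡ r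
          ; new-h = Replacing.new-h r ; newest = Replacing.newest r })

        live-copy′ : ∀ {e} → e ∈ items → ∃[ v ] v ∈ hist G × v ∉ ret G′ × item (heap m v) ≡ e
        live-copy′ e∈ with live-copy e∈
        ... | v , v∈ , v∉ , eq with v ℕ.≟ h
        ...   | yes refl = f , f∈ , f∉ret , trans (sym R.item≡) eq
        ...   | no v≢h = v , v∈ , (λ { (here refl) → v≢h refl ; (there v∈r) → v∉ v∈r }) , eq

        new-ok′ : ∀ {x} → x ∈ hist G → ∀ n → new (heap m x) ≡ n → NewOK m G x n → NewOK m G′ x n
        new-ok′ x∈ (ptr nothing) eq x∉ (here refl) with R.new-h
        ... | inj₁ eq′ = case trans (sym eq) eq′ of λ ()
        ... | inj₂ eq′ = case trans (sym eq) eq′ of λ ()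
        new-ok′ x∈ (ptr nothing) eq x∉ (there x∈r) = x∉ x∈r
        new-ok′ {x} x∈ (ptr (just g)) eq (g∈ , i , o , l) = g∈ , i , old-is′ o , l′
          where
          l′ : g ∉ hist G → x ∉ ret G′
          l′ g∉ (there x∈r) = l g∉ x∈r
          l′ g∉ (here refl) with R.new-h
          ... | inj₂ eq′ = case trans (sym eq) eq′ of λ ()
          ... | inj₁ eq′ with trans (sym eq) eq′
          ...   | refl = g∉ f∈
        new-ok′ x∈ GONE eq x∈r = there x∈r

        linked′ : ∀ {x} → x ∈ hist G →
                  Linked m G′ x ⊎ (next (heap m x) ≡ nothing × old (heap m x) ≢ DONE)
        linked′ x∈ with linked x∈
        ... | inj₁ l = inj₁ (goodLink′ l)
        ... | inj₂ r = inj₂ r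

      retire-evolves : Evolves N m G m G′
      retire-evolves = record
        { alloc⊆ = λ x∈ → x∈ ; pub⊆ = λ x∈ → x∈ ; ret⊆ = there
        ; hist-step = inj₁ (refl , refl)
        ; item≡ = λ _ → refl
        ; done = λ _ d → d ; old-is = λ _ → old-is′
        ; new-ptr = λ _ eq → inj₁ eq ; new-gone = λ _ eq → eq
        ; link = λ _ → goodLink′ ; goodLink = λ _ → goodLink′
        ; private- = λ _ _ x∉ → x∉ , refl , refl , refl , λ eq → eq
        ; unpub = λ _ x∈ u → u , refl }

    module Announce {a : Fin p → Announcement} {g : Addr} (g∈ : g ∈ allocated m) (g∉ : g ∉ pub G)
                    (next≡ : next (heap m g) ≡ nothing) (new≡ : new (heap m g) ≡ ptr nothing) where

      private
        m′ : Memory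
        m′ = record m { A = a }

      G′ : Ghost
      G′ = record G { pub = g ∷ pub G }

      private
        goodLink′ : ∀ {x y} → GoodLink m G x y → GoodLink m′ G′ x y
        goodLink′ gl = record { settled = settled gl ; covers = covers gl }

      announce-inv : MemInv m′ G′
      announce-inv = record
        { front = front ; second = second ; rest = rest ; hist≡ = hist≡ ; Head≡ = Head≡
        ; hist⊆pub = there ∘ hist⊆pub
        ; pub⊆alloc = λ { (here refl) → g∈ ; (there x∈) → pub⊆alloc x∈ }
        ; ret-settled = ret-settled
        ; second-done = second-done
        ; behind-done = behind-done
        ; front-old = front-old′
        ; item∈items = item∈items
        ; live-copy = live-copy
        ; superseded = superseded
        ; new-ok = λ {x} x∈ → new-ok′ (new (heap m x)) (new-ok x∈)
        ; linked = linked′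
        ; unlisted = λ { (here refl) _ → next≡ , new≡ ; (there x∈) x∉ → unlisted x∈ x∉ } }
        where
        front-old′ : old (heap m front) ≡ DONE ⊎ ∃[ h ] Replacing m′ G′ front h
        front-old′ with front-old
        ... | inj₁ d = inj₁ d
        ... | inj₂ (y , r) = inj₂ (y , record
          { old≡ = Replacing.old≡ r ; h-settled = Replacing.h-settled r ; item≡ = Replacing.item≡ r
          ; new-h = Replacing.new-h r ; newest = Replacing.newest r })
        new-ok′ : ∀ {x} n → NewOK m G x n → NewOK m′ G′ x n
        new-ok′ (ptr nothing) ok = ok
        new-ok′ (ptr (just g)) (g∈ , r) = there g∈ , r
        new-ok′ GONE ok = ok
        linked′ : ∀ {x} → x ∈ hist G →
                  Linked m′ G′ x ⊎ (next (heap m x) ≡ nothing × old (heap m x) ≢ DONE)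
        linked′ x∈ with linked x∈
        ... | inj₁ l = inj₁ (goodLink′ l)
        ... | inj₂ r = inj₂ r

      announce-evolves : Evolves (_≡ g) m G m′ G′
      announce-evolves = record
        { alloc⊆ = λ x∈ → x∈ ; pub⊆ = there ; ret⊆ = λ x∈ → x∈
        ; hist-step = inj₁ (refl , refl)
        ; item≡ = λ _ → refl
        ; done = λ _ d → d ; old-is = λ _ o → o
        ; new-ptr = λ _ eq → inj₁ eq ; new-gone = λ _ eq → eq
        ; link = λ _ → goodLink′ ; goodLink = λ _ → goodLink′
        ; private- = λ ¬N x∈ x∉ → (λ { (here refl) → ¬N refl ; (there x∈) → x∉ x∈ })
                               , refl , refl , refl , λ eq → eq
        ; unpub = λ _ x∈ u → u , refl }

      -- `NewOK` admits only members of `pub` as targets of new fields, so none can name `g` yet.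
      announce-unpublished : Unpublished m G g
      announce-unpublished = g∉ ∘ hist⊆pub , λ {y} y∈ eq → g∉ (proj₁ (subst (NewOK m G y) eq (new-ok y∈)))

  -- The states in which a search for the item of x, not yet notified, may be
  -- while x is at the front and its predecessor copy is being replaced: it
  -- will find x when it looks at the first node.
  data Awaits (x : Addr) : ProcState → Set where
    at-readHead : ∀ {e g} → Awaits x (searching e g readHead)
    at-compare  : ∀ {e g h} → Awaits x (searching e g (compareFirst (just x) h))
    at-withdraw : ∀ {e g h} → Awaits x (searching e g (withdraw h))

  -- The aim of the notification loop for index `j`. It is vacuous for a process that is idle,
  -- notified, or looking for another item; what is left are the searches that will return at the
  -- first node without being notified.
  Safe : Config → Addr → Fin p → Set
  Safe C x j = ∀ {a} → A (mem C) j ≡ (a , just (item (heap (mem C) x))) → Awaits x (proc C j)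

  nodeOf : ProcState → Maybe Addr
  nodeOf idle              = nothing
  nodeOf (allocating e)    = nothing
  nodeOf (searching e g l) = just g

  -- Assertions about the individual processes along an execution.

  module Run (E : Execution) where
    open Execution E

    -- A search is identified by its process, item and node rather than by its starting time,
    -- because helpers learn only these from an announcement. The freshness of `g` turns this into a
    -- fact about one particular search in `announced-after-start`.
    Announced : ℕ → Fin p → Item → Addr → Set
    Announced t j e g = ∃[ s ] s < t × event s ≡ access j × proc (conf s) j ≡ searching e g announce

    AtFront : ℕ → Fin p → Item → Addr → Addr → Set
    AtFront u j e g v =
      Announced u j e g × proj₁ (Head (mem (conf u))) ≡ just v × item (heap (mem (conf u)) v) ≡ e

    WasFront : ℕ → Fin p → Item → Addr → Addr → Set
    WasFront t j e g v = ∃[ u ] u ≤ t × AtFront u j e g v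

    HeadRead : ℕ → Fin p → Item → Addr → Addr → Set
    HeadRead t j e g v =
      ∃[ u ] u < t × event u ≡ access j × proc (conf u) j ≡ searching e g readHead × AtFront u j e g v

    announced⁺ : ∀ {t j e g} → Announced t j e g → Announced (suc t) j e g
    announced⁺ (s , s<t , r) = s , m≤n⇒m≤1+n s<t , r

    wasFront⁺ : ∀ {t j e g v} → WasFront t j e g v → WasFront (suc t) j e g v
    wasFront⁺ (u , u≤t , r) = u , m≤n⇒m≤1+n u≤t , r

    headRead⁺ : ∀ {t j e g v} → HeadRead t j e g v → HeadRead (suc t) j e g v
    headRead⁺ (u , u<t , r) = u , m≤n⇒m≤1+n u<t , r

    module Assertions (t : ℕ) (C : Config) (G : Ghost) where
      private
        m = mem C

      Unnotified : Fin p → Item → Addr → Set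
      Unnotified i e g = A m i ≡ (just g , just e)

      record Active (i : Fin p) (e : Item) (g : Addr) : Set where
        field
          g∈pub     : g ∈ pub G
          item≡     : item (heap m g) ≡ e
          announced : Announced t i e g
          A-value   : Unnotified i e g
                    ⊎ ∃[ v ] A m i ≡ (just v , nothing) × e ∈ items × WasFront t i e g v

      Private : Fin p → Addr → Set
      Private i g = g ∈ allocated m × g ∉ pub G × A m i ≡ (nothing , nothing)

      Fresh : Addr → Set
      Fresh g = Unpublished m G g × old (heap m g) ≡ ptr nothing

      -- The promise of a live copy ahead is conditional on `Unnotified`: once the search is
      -- notified, the copy may be retired and unlinked under its feet, and the traversal has
      -- nothing left to find.
      Traversing : Fin p → Item → Addr → Addr → Set
      Traversing i e g h = Settled m G h × (Unnotified i e g → e ∈ items →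
        ∃[ v ] v ∈ hist G × v ∉ ret G × item (heap m v) ≡ e × rank (hist G) v ≤ rank (hist G) h)

      AtItem : Fin p → Item → Addr → Addr → Set
      AtItem i e g h = Settled m G h × item (heap m h) ≡ e × (Unnotified i e g → h ∉ ret G)

      CopyOf : Addr → Addr → Set
      CopyOf g′ h = h ∈ hist G × g′ ∈ pub G × OldIs m G g′ h
                  × (new (heap m h) ≡ ptr (just g′) ⊎ (new (heap m h) ≡ GONE × g′ ∈ hist G))

      Helping : Addr → Ptr → Set
      Helping f h′ = f ∈ hist G × Linked m G f × ∃[ h ] h′ ≡ just h × OldIs m G f h

      Retired : Addr → Addr → Set
      Retired f h = f ∈ hist G × Linked m G f × OldIs m G f h × h ∈ ret G

      -- The premise releases a helper that lags behind: when `f` is `DONE`, `OldIs` already says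
      -- that the replaced node is retired, and the safety of the processes is no longer in
      -- question.
      AllSafeBut : Addr → List (Fin p) → Set
      AllSafeBut f js = old (heap m f) ≢ DONE → ∀ j → j ∈ js ⊎ Safe C f j

      Looping : Addr → Ptr → Item → List (Fin p) → Set
      Looping f h′ e′ js = Helping f h′ × e′ ≡ item (heap m f) × AllSafeBut f js

      -- Prepares for a CAS that may fail. Any change of an announcement leaves its process safe for
      -- every node, so index `j` can be crossed off whether or not the pair read is still in place.
      ReadBy : Addr → Item → Fin p → Announcement → Set
      ReadBy f e′ j ab = ∃[ a ] ab ≡ (just a , just e′) × Announced t j e′ a
                              × (old (heap m f) ≢ DONE → A m j ≡ ab ⊎ Safe C f j)

      MTFInv : Addr → MTFLine → Set
      MTFInv g′ testDone = ⊤
      MTFInv g′ readHead = ⊤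
      MTFInv g′ (readOld h₁ h₂) = ∃[ f ] h₁ ≡ just f × f ∈ hist G × GoodLink m G f h₂
      MTFInv g′ (retestDone f h₂) = Settled m G f
      -- No node enters hist twice, so Head never returns to an earlier value and
      -- a CAS that has been overtaken fails.
      MTFInv g′ (moveHead f h₂) = Settled m G f × (Head m ≡ (just f , h₂) → g′ ∉ hist G)
      MTFInv g′ (linkNext f h₂ h′) = f ∈ hist G × GoodLink m G f h₂ × ∃[ h ] h′ ≡ just h × OldIs m G f h
      MTFInv g′ (linkPrev f h₂ h′) = Helping f h′
      MTFInv g′ (readItem f h′) = Helping f h′
      MTFInv g′ (readA f h′ e′ j js) = Looping f h′ e′ (j ∷ js)
      MTFInv g′ (testOld f h′ e′ j js ab) = Looping f h′ e′ (j ∷ js) × ReadBy f e′ j ab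
      MTFInv g′ (notify f h′ e′ j js ab) = Looping f h′ e′ (j ∷ js) × ReadBy f e′ j ab
        × (∀ {a} → ab ≡ (just a , just e′) → WasFront t j e′ a f)
      MTFInv g′ (readPrev f h′) = Helping f h′ × AllSafeBut f []
      MTFInv g′ (readNext f h pred) = Retired f h
      MTFInv g′ (unlinkNext f h pred succ) = Retired f h × GoodLink m G h succ
      MTFInv g′ (unlinkPrev f h pred succ) = Retired f h
      MTFInv g′ (markGone f h) = Retired f h
      MTFInv g′ (markDone f h) = Retired f h

      ResultOK : Fin p → Item → Addr → Result → Set
      ResultOK i e g r = (e ∈ items → ∃[ v ] r ≡ found (just v) × WasFront t i e g v)
                       × (e ∉ items → r ≡ notPresent)

      LineInv : Fin p → Item → Addr → Line → Set
      LineInv i e g writeItem = Private i g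
      LineInv i e g writePrev = Private i g × item (heap m g) ≡ e
      LineInv i e g writeNext = Private i g × item (heap m g) ≡ e
      LineInv i e g writeOld = Private i g × item (heap m g) ≡ e × next (heap m g) ≡ nothing
      LineInv i e g writeNew = Private i g × item (heap m g) ≡ e × next (heap m g) ≡ nothing
        × old (heap m g) ≡ ptr nothing
      LineInv i e g announce = Private i g × item (heap m g) ≡ e × next (heap m g) ≡ nothing
        × old (heap m g) ≡ ptr nothing × new (heap m g) ≡ ptr nothing
      LineInv i e g readHead = Active i e g × Fresh g
      LineInv i e g (compareFirst h₁ h₂) = Active i e g × Fresh g
        × ∃[ f ] h₁ ≡ just f × f ∈ hist G
        × (item (heap m f) ≡ e → HeadRead t i e g f)
        × (item (heap m f) ≢ e → ∃[ h ] h₂ ≡ just h × Traversing i e g h)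
      LineInv i e g (withdraw h₁) = Active i e g
        × ∃[ f ] h₁ ≡ just f × f ∈ hist G × item (heap m f) ≡ e × HeadRead t i e g f
      LineInv i e g (compareItem h c) = Active i e g × Fresh g × Traversing i e g h
      LineInv i e g (checkAtItem h) = Active i e g × Fresh g × AtItem i e g h
      LineInv i e g (setOld h) = Active i e g × Fresh g × AtItem i e g h
      LineInv i e g (setNew h) =
        Active i e g × Unpublished m G g × old (heap m g) ≡ ptr (just h) × AtItem i e g h
      LineInv i e g (readNew h) = Active i e g × AtItem i e g h
      -- No transition leaves this control point, so a weak assertion suffices.
      LineInv i e g (moveToFront nothing l) = Active i e g
      LineInv i e g (moveToFront (just g′) l) =
        Active i e g × (∃[ h ] AtItem i e g h × CopyOf g′ h) × MTFInv g′ l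
      LineInv i e g readResult = Active i e g × e ∈ items × ¬ Unnotified i e g
      LineInv i e g (checkPeriod h c) =
        Active i e g × Fresh g × Traversing i e g h × item (heap m h) ≢ e
      LineInv i e g (advance h c) =
        Active i e g × Fresh g × Traversing i e g h × item (heap m h) ≢ e
      LineInv i e g checkAtEnd = Active i e g × (e ∈ items → ¬ Unnotified i e g)
      LineInv i e g (clear ab r) =
        Active i e g × (e ∈ items → ¬ Unnotified i e g) × A m i ≡ ab × ResultOK i e g r
      LineInv i e g (returning r) = g ∈ pub G × A m i ≡ (nothing , nothing) × ResultOK i e g r

      ProcInv : Fin p → ProcState → Set
      ProcInv i idle              = A m i ≡ (nothing , nothing)
      ProcInv i (allocating e)    = A m i ≡ (nothing , nothing)
      ProcInv i (searching e g l) = LineInv i e g l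

    -- The owner's own CASs are exempt. Everybody else can only notify, and hands over the front
    -- time that justifies the answer.
    AStep : ℕ → Config → Config → Fin p → Set
    AStep t C C′ j = A (mem C′) j ≡ A (mem C) j
      ⊎ ∃[ g ] ∃[ e ] ∃[ v ] A (mem C) j ≡ (just g , just e) × A (mem C′) j ≡ (just v , nothing)
                           × e ∈ items × WasFront t j e g v

    -- `ret-step` attaches to each retirement a copy for which everybody is safe; from this an
    -- unnotified search that awaits no copy of the item concludes that the retirement cannot
    -- happen. `A-change` is what makes failing notifications harmless.
    record Change (N : Addr → Set) (C : Config) (G : Ghost) (C′ : Config) (G′ : Ghost) : Set where
      field
        inv      : MemInv (mem C) G
        inv′     : MemInv (mem C′) G′
        evolves  : Evolves N (mem C) G (mem C′) G′
        ret-step : ∀ {x} → x ∈ ret G′ → x ∈ ret G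
                 ⊎ ∃[ f ] f ∈ hist G × item (heap (mem C) f) ≡ item (heap (mem C) x) × (∀ j → Safe C f j)
        safe     : ∀ {x} j → x ∈ hist G → old (heap (mem C) x) ≢ DONE → Safe C x j → Safe C′ x j
        A-change : ∀ j → A (mem C′) j ≡ A (mem C) j ⊎ (∀ x → Safe C′ x j)

    -- Stability of the assertions.

    module Stability {N : Addr → Set} {t : ℕ} {C : Config} {G : Ghost} {C′ : Config} {G′ : Ghost}
                     (change : Change N C G C′ G′) where
      open Change change
      open Evolves evolves
      private
        m  = mem C
        m′ = mem C′
        module S  = Assertions t C G
        module S′ = Assertions (suc t) C′ G′
        module I  = MemInv inv
        module I′ = MemInv inv′

      item-hist : ∀ {x} → x ∈ hist G → item (heap m′ x) ≡ item (heap m x)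
      item-hist x∈ = item≡ (I.hist⊆pub x∈)

      undone⁻ : ∀ {x} → x ∈ hist G → old (heap m′ x) ≢ DONE → old (heap m x) ≢ DONE
      undone⁻ x∈ ¬d d = ¬d (done x∈ d)

      unnotified⁻ : ∀ {i e g} → AStep t C C′ i → S′.Unnotified i e g → S.Unnotified i e g
      unnotified⁻ (inj₁ eq) u = trans (sym eq) u
      unnotified⁻ (inj₂ (_ , _ , _ , _ , eq , _)) u = case trans (sym eq) u of λ ()

      A-NULL : ∀ {i} → AStep t C C′ i → A m i ≡ (nothing , nothing) → A m′ i ≡ (nothing , nothing)
      A-NULL (inj₁ eq) a = trans eq a
      A-NULL (inj₂ (_ , _ , _ , eq , _)) a = case trans (sym a) eq of λ ()

      active : ∀ {i e g} → AStep t C C′ i → S.Active i e g → S′.Active i e g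
      active {i} {e} {g} a-step act = record
        { g∈pub = pub⊆ g∈pub ; item≡ = trans (Evolves.item≡ evolves g∈pub) (S.Active.item≡ act)
        ; announced = announced⁺ announced ; A-value = go a-step A-value }
        where
        open S.Active act hiding (item≡)
        go : AStep t C C′ i →
             S.Unnotified i e g ⊎ ∃[ v ] A m i ≡ (just v , nothing) × e ∈ items × WasFront t i e g v →
             S′.Unnotified i e g ⊎ ∃[ v ] A m′ i ≡ (just v , nothing) × e ∈ items × WasFront (suc t) i e g v
        go (inj₁ eq) (inj₁ u) = inj₁ (trans eq u)
        go (inj₁ eq) (inj₂ (v , a , e∈ , w)) = inj₂ (v , trans eq a , e∈ , wasFront⁺ w)
        go (inj₂ (_ , _ , v , a , a′ , e∈ , w)) (inj₁ u) with trans (sym a) u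
        ... | refl = inj₂ (v , a′ , e∈ , wasFront⁺ w)
        go (inj₂ (_ , _ , _ , a , _)) (inj₂ (_ , a′ , _)) = case trans (sym a) a′ of λ ()

      private-node : ∀ {i g} → ¬ N g → AStep t C C′ i → S.Private i g → S′.Private i g
      private-node ¬N a-step (g∈ , g∉ , a) =
        alloc⊆ g∈ , proj₁ (private- ¬N g∈ g∉) , A-NULL a-step a

      fresh : ∀ {i e g} → ¬ N g → S.Active i e g → S.Fresh g → S′.Fresh g
      fresh ¬N act (u , o) =
        let (u′ , eq) = unpub ¬N (S.Active.g∈pub act) u in u′ , trans eq o

      Quiet : Fin p → Item → Set
      Quiet i e = ∀ {f} → item (heap m f) ≡ e → ¬ Awaits f (proc C i)

      -- Retirement requires every process to be safe, which for an unnotified search for this item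
      -- means that it awaits the replacement. A quiet search does not, so it blocks the retirement
      -- of all copies of its item.
      unretired : ∀ {i e g x} → Quiet i e → S.Unnotified i e g → item (heap m x) ≡ e →
                  x ∉ ret G → x ∉ ret G′
      unretired quiet u eq x∉ x∈ with ret-step x∈
      ... | inj₁ x∈r = x∉ x∈r
      ... | inj₂ (f , f∈ , eq′ , safe-all) =
        quiet (trans eq′ eq) (safe-all _ (trans u (cong (λ e → just _ , just e) (sym (trans eq′ eq)))))

      traversing : ∀ {i e g h} → AStep t C C′ i → Quiet i e → S.Traversing i e g h → S′.Traversing i e g h
      traversing {h = h} a-step quiet (h-settled , target) = settled⊆ h-settled , λ u e∈ →
        let u₀ = unnotified⁻ a-step u
            (v , v∈ , v∉ , eq , v≤h) = target u₀ e∈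
        in v , hist⊆ v∈ , unretired quiet u₀ eq v∉ , trans (item-hist v∈) eq
           , subst₂ _≤_ (sym (rank≡ v∈)) (sym (rank≡ (proj₁ h-settled))) v≤h

      atItem : ∀ {i e g h} → AStep t C C′ i → Quiet i e → S.AtItem i e g h → S′.AtItem i e g h
      atItem a-step quiet (h-settled , eq , live) =
        settled⊆ h-settled , trans (item-hist (proj₁ h-settled)) eq
        , λ u → let u₀ = unnotified⁻ a-step u in unretired quiet u₀ eq (live u₀)

      copyOf : ∀ {g′ h} → S.CopyOf g′ h → S′.CopyOf g′ h
      copyOf {g′} {h} (h∈ , g∈ , o , n) = hist⊆ h∈ , pub⊆ g∈ , old-is g∈ o , go n
        where
        go : new (heap m h) ≡ ptr (just g′) ⊎ (new (heap m h) ≡ GONE × g′ ∈ hist G) →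
             new (heap m′ h) ≡ ptr (just g′) ⊎ (new (heap m′ h) ≡ GONE × g′ ∈ hist G′)
        go (inj₁ eq) with new-ptr h∈ eq
        ... | inj₁ eq′ = inj₁ eq′
        ... | inj₂ (eq′ , g∈h) = inj₂ (eq′ , hist⊆ g∈h)
        go (inj₂ (eq , g∈h)) = inj₂ (new-gone h∈ eq , hist⊆ g∈h)

      helping : ∀ {f h′} → S.Helping f h′ → S′.Helping f h′
      helping (f∈ , l , h , eq , o) = hist⊆ f∈ , link f∈ l , h , eq , old-is (I.hist⊆pub f∈) o

      retired : ∀ {f h} → S.Retired f h → S′.Retired f h
      retired (f∈ , l , o , h∈) = hist⊆ f∈ , link f∈ l , old-is (I.hist⊆pub f∈) o , ret⊆ h∈

      allSafeBut : ∀ {f js} → f ∈ hist G → S.AllSafeBut f js → S′.AllSafeBut f js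
      allSafeBut f∈ s ¬d j with s (undone⁻ f∈ ¬d) j
      ... | inj₁ j∈ = inj₁ j∈
      ... | inj₂ sf = inj₂ (safe j f∈ (undone⁻ f∈ ¬d) sf)

      looping : ∀ {f h′ e′ js} → S.Looping f h′ e′ js → S′.Looping f h′ e′ js
      looping (hp , eq , s) =
        helping hp , trans eq (sym (item-hist (proj₁ hp))) , allSafeBut (proj₁ hp) s

      pending-CAS : ∀ {f j ab} → f ∈ hist G →
                    (old (heap m f) ≢ DONE → A m j ≡ ab ⊎ Safe C f j) →
                    old (heap m′ f) ≢ DONE → A m′ j ≡ ab ⊎ Safe C′ f j
      pending-CAS {f} {j} f∈ r ¬d with r (undone⁻ f∈ ¬d)
      ... | inj₂ sf = inj₂ (safe j f∈ (undone⁻ f∈ ¬d) sf)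
      ... | inj₁ eq with A-change j
      ...   | inj₁ eq′ = inj₁ (trans eq′ eq)
      ...   | inj₂ sf  = inj₂ (sf f)

      readBy : ∀ {f e′ j ab} → f ∈ hist G → S.ReadBy f e′ j ab → S′.ReadBy f e′ j ab
      readBy f∈ (a , eq , an , r) = a , eq , announced⁺ an , pending-CAS f∈ r

      Head-fixed : ∀ {f h₂ g′} → f ∈ hist G → (Head m ≡ (just f , h₂) → g′ ∉ hist G) →
                   Head m′ ≡ (just f , h₂) → g′ ∉ hist G′
      Head-fixed {g′ = g′} f∈ unlisted hd with hist-step
      ... | inj₁ (eq , eq′) = subst (g′ ∉_) (sym eq) (unlisted (trans (sym eq′) hd))
      ... | inj₂ (y , _ , y∉ , hd′ , _) with trans (sym (cong proj₁ hd)) hd′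
      ...   | refl = ⊥-elim (y∉ f∈)

      mtfInv : ∀ {g′} l → S.MTFInv g′ l → S′.MTFInv g′ l
      mtfInv testDone _ = tt
      mtfInv readHead _ = tt
      mtfInv (readOld h₁ h₂) (f , eq , f∈ , gl) = f , eq , hist⊆ f∈ , goodLink f∈ gl
      mtfInv (retestDone f h₂) s = settled⊆ s
      mtfInv (moveHead f h₂) (s , hd) = settled⊆ s , Head-fixed (proj₁ s) hd
      mtfInv (linkNext f h₂ h′) (f∈ , gl , h , eq , o) =
        hist⊆ f∈ , goodLink f∈ gl , h , eq , old-is (I.hist⊆pub f∈) o
      mtfInv (linkPrev f h₂ h′) hp = helping hp
      mtfInv (readItem f h′) hp = helping hp
      mtfInv (readA f h′ e′ j js) lp = looping lp
      mtfInv (testOld f h′ e′ j js ab) (lp , r) = looping lp , readBy (proj₁ (proj₁ lp)) r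
      mtfInv (notify f h′ e′ j js ab) (lp , r , w) =
        looping lp , readBy (proj₁ (proj₁ lp)) r , λ eq → wasFront⁺ (w eq)
      mtfInv (readPrev f h′) (hp , s) = helping hp , allSafeBut (proj₁ hp) s
      mtfInv (readNext f h pred) r = retired r
      mtfInv (unlinkNext f h pred succ) (r , gl) =
        retired r , goodLink (proj₁ (I.ret-settled (proj₂ (proj₂ (proj₂ r))))) gl
      mtfInv (unlinkPrev f h pred succ) r = retired r
      mtfInv (markGone f h) r = retired r
      mtfInv (markDone f h) r = retired r

      resultOK : ∀ {i e g r} → S.ResultOK i e g r → S′.ResultOK i e g r
      resultOK (present , absent) =
        (λ e∈ → let (v , eq , w) = present e∈ in v , eq , wasFront⁺ w) , absent

      -- A notification replaces an announcement that still shows an item of the set. That is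
      -- excluded once such a search has been notified, so the value that the search has read stays
      -- until its own final CAS, which therefore succeeds.
      settled-value : ∀ {i e g ab} → AStep t C C′ i → S.Active i e g → (e ∈ items → ¬ S.Unnotified i e g) →
                      A m i ≡ ab → A m′ i ≡ ab
      settled-value (inj₁ eq) _ _ a = trans eq a
      settled-value (inj₂ (_ , _ , _ , a , _ , e∈ , _)) act ¬u _ with S.Active.A-value act
      ... | inj₂ (_ , a′ , _) = case trans (sym a) a′ of λ ()
      ... | inj₁ u with trans (sym a) u
      ...   | refl = ⊥-elim (¬u e∈ u)

      lineInv : ∀ {i e g} l → ¬ N g → AStep t C C′ i → proc C i ≡ searching e g l →
                S.LineInv i e g l → S′.LineInv i e g l
      lineInv {i} {e} {g} l ¬N st eq = go l eq
        where
        quiet : ∀ {l} → proc C i ≡ searching e g l → (∀ {f} → ¬ Awaits f (searching e g l)) → Quiet i e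
        quiet eq ¬a _ aw = ¬a (subst (Awaits _) eq aw)
        priv : S.Private i g → S′.Private i g
        priv = private-node ¬N st
        item-p : S.Private i g → item (heap m g) ≡ e → item (heap m′ g) ≡ e
        item-p (g∈ , g∉ , _) = trans (proj₁ (proj₂ (private- ¬N g∈ g∉)))
        old-p : S.Private i g → old (heap m g) ≡ ptr nothing → old (heap m′ g) ≡ ptr nothing
        old-p (g∈ , g∉ , _) = trans (proj₁ (proj₂ (proj₂ (private- ¬N g∈ g∉))))
        new-p : S.Private i g → new (heap m g) ≡ ptr nothing → new (heap m′ g) ≡ ptr nothing
        new-p (g∈ , g∉ , _) = trans (proj₁ (proj₂ (proj₂ (proj₂ (private- ¬N g∈ g∉)))))
        next-p : S.Private i g → next (heap m g) ≡ nothing → next (heap m′ g) ≡ nothing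
        next-p (g∈ , g∉ , _) = proj₂ (proj₂ (proj₂ (proj₂ (private- ¬N g∈ g∉))))
        go : ∀ l → proc C i ≡ searching e g l → S.LineInv i e g l → S′.LineInv i e g l
        go writeItem eq pr = priv pr
        go writePrev eq (pr , i≡) = priv pr , item-p pr i≡
        go writeNext eq (pr , i≡) = priv pr , item-p pr i≡
        go writeOld eq (pr , i≡ , n≡) = priv pr , item-p pr i≡ , next-p pr n≡
        go writeNew eq (pr , i≡ , n≡ , o≡) = priv pr , item-p pr i≡ , next-p pr n≡ , old-p pr o≡
        go announce eq (pr , i≡ , n≡ , o≡ , w≡) =
          priv pr , item-p pr i≡ , next-p pr n≡ , old-p pr o≡ , new-p pr w≡
        go readHead eq (act , fr) = active st act , fresh ¬N act fr
        go (compareFirst h₁ h₂) eq (act , fr , f , h₁≡ , f∈ , yes′ , no′) =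
          active st act , fresh ¬N act fr , f , h₁≡ , hist⊆ f∈
          , (λ i≡ → headRead⁺ (yes′ (trans (sym (item-hist f∈)) i≡)))
          , λ i≢ → let i≢₀ = λ i≡ → i≢ (trans (item-hist f∈) i≡) ; (h , h₂≡ , tr) = no′ i≢₀ in
              h , h₂≡ , traversing st (quiet′ i≢₀ h₁≡) tr
          where
          -- At this line only `f` can be awaited, and `f` does not carry `e`.
          quiet′ : item (heap m f) ≢ e → h₁ ≡ just f → Quiet i e
          quiet′ i≢ refl i≡ aw with subst (Awaits _) eq aw
          ... | at-compare = i≢ i≡
        go (withdraw h₁) eq (act , f , h₁≡ , f∈ , i≡ , hr) =
          active st act , f , h₁≡ , hist⊆ f∈ , trans (item-hist f∈) i≡ , headRead⁺ hr
        go (compareItem h c) eq (act , fr , tr) =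
          active st act , fresh ¬N act fr , traversing st (quiet eq λ ()) tr
        go (checkAtItem h) eq (act , fr , at) =
          active st act , fresh ¬N act fr , atItem st (quiet eq λ ()) at
        go (setOld h) eq (act , fr , at) =
          active st act , fresh ¬N act fr , atItem st (quiet eq λ ()) at
        go (setNew h) eq (act , u , o , at) =
          let (u′ , o≡) = unpub ¬N (S.Active.g∈pub act) u in
          active st act , u′ , trans o≡ o , atItem st (quiet eq λ ()) at
        go (readNew h) eq (act , at) = active st act , atItem st (quiet eq λ ()) at
        go (moveToFront nothing l) eq act = active st act
        go (moveToFront (just g′) l) eq (act , (h , at , cp) , mi) =
          active st act , (h , atItem st (quiet eq λ ()) at , copyOf cp) , mtfInv l mi
        go readResult eq (act , e∈ , ¬u) = active st act , e∈ , ¬u ∘ unnotified⁻ st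
        go (checkPeriod h c) eq (act , fr , tr , i≢) =
          active st act , fresh ¬N act fr , traversing st (quiet eq λ ()) tr
          , λ i≡ → i≢ (trans (sym (item-hist (proj₁ (proj₁ tr)))) i≡)
        go (advance h c) eq (act , fr , tr , i≢) =
          active st act , fresh ¬N act fr , traversing st (quiet eq λ ()) tr
          , λ i≡ → i≢ (trans (sym (item-hist (proj₁ (proj₁ tr)))) i≡)
        go checkAtEnd eq (act , ¬u) = active st act , λ e∈ → ¬u e∈ ∘ unnotified⁻ st
        go (clear ab r) eq (act , ¬u , a≡ , ok) =
          active st act , (λ e∈ → ¬u e∈ ∘ unnotified⁻ st) , settled-value st act ¬u a≡ , resultOK ok
        go (returning r) eq (g∈ , a≡ , ok) = pub⊆ g∈ , A-NULL st a≡ , resultOK ok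

      procInv : ∀ {i} ps → (∀ {g} → nodeOf ps ≡ just g → ¬ N g) → AStep t C C′ i → proc C i ≡ ps →
                S.ProcInv i ps → S′.ProcInv i ps
      procInv idle ¬N st eq inv = A-NULL st inv
      procInv (allocating e) ¬N st eq inv = A-NULL st inv
      procInv (searching e g l) ¬N st eq inv = lineInv l (¬N refl) st eq inv

    moved : Config → Fin p → Memory → ProcState → Config
    moved C i m′ ps = record { mem = m′ ; proc = updateAt (proc C) i (λ _ → ps) }

    module _ {N : Addr → Set} {t : ℕ} {C : Config} {G : Ghost}
             {i : Fin p} {m′ : Memory} {G′ : Ghost} {ps : ProcState}
             (inv : MemInv (mem C) G) (inv′ : MemInv m′ G′) (ev : Evolves N (mem C) G m′ G′)
             (ret-step : ∀ {x} → x ∈ ret G′ → x ∈ ret G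
               ⊎ ∃[ f ] f ∈ hist G × item (heap (mem C) f) ≡ item (heap (mem C) x) × (∀ j → Safe C f j)) where
      private
        C′ = moved C i m′ ps

      notified-safe : ∀ {x j} → proj₂ (A m′ j) ≡ nothing → Safe C′ x j
      notified-safe eq a = case trans (sym eq) (cong proj₂ a) of λ ()

      change : (∀ j → j ≢ i → AStep t C C′ j) →
               A m′ i ≡ A (mem C) i ⊎ (∀ x → Safe C′ x i) →
               (∀ {x} → x ∈ hist G → old (heap (mem C) x) ≢ DONE → Safe C x i → Safe C′ x i) →
               Change N C G C′ G′
      change others self-A self-safe = record
        { inv = inv ; inv′ = inv′ ; evolves = ev ; ret-step = ret-step ; safe = safe′ ; A-change = A-change′ }
        where
        A-change′ : ∀ j → A m′ j ≡ A (mem C) j ⊎ (∀ x → Safe C′ x j)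
        A-change′ j with j Fin.≟ i
        ... | yes refl = self-A
        ... | no  j≢i with others j j≢i
        ...   | inj₁ eq = inj₁ eq
        ...   | inj₂ (_ , _ , _ , _ , eq , _) = inj₂ λ x → notified-safe (cong proj₂ eq)
        safe′ : ∀ {x} j → x ∈ hist G → old (heap (mem C) x) ≢ DONE → Safe C x j → Safe C′ x j
        safe′ {x} j x∈ ¬d sf with j Fin.≟ i
        ... | yes refl = self-safe x∈ ¬d sf
        ... | no  j≢i with others j j≢i
        ...   | inj₁ eq = λ a → subst (Awaits x) (sym (updateAt-minimal j i (proc C) j≢i))
                  (sf (trans (sym eq) (trans a
                    (cong (λ e → _ , just e) (Evolves.item≡ ev (MemInv.hist⊆pub inv x∈))))))
        ...   | inj₂ (_ , _ , _ , _ , eq , _) = notified-safe (cong proj₂ eq)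

      -- A process that awaits nothing can be safe only through its announcement, so moving on to
      -- another line does not endanger its safety.
      change-quiet : (∀ {x} → ¬ Awaits x (proc C i)) → (∀ j → AStep t C C′ j) → Change N C G C′ G′
      change-quiet ¬a steps = change (λ j _ → steps j) self-A self-safe
        where
        self-A : A m′ i ≡ A (mem C) i ⊎ (∀ x → Safe C′ x i)
        self-A with steps i
        ... | inj₁ eq = inj₁ eq
        ... | inj₂ (_ , _ , _ , _ , eq , _) = inj₂ λ x → notified-safe (cong proj₂ eq)
        self-safe : ∀ {x} → x ∈ hist G → old (heap (mem C) x) ≢ DONE → Safe C x i → Safe C′ x i
        self-safe {x} x∈ _ sf with steps i
        ... | inj₁ eq = λ a → ⊥-elim (¬a (sf (trans (sym eq)
                (trans a (cong (λ e → _ , just e) (Evolves.item≡ ev (MemInv.hist⊆pub inv x∈)))))))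
        ... | inj₂ (_ , _ , _ , _ , eq , _) = notified-safe (cong proj₂ eq)

    -- Preservation by the steps of MOVE-TO-FRONT.

    module MTFPreservation {t : ℕ} {G : Ghost} {i : Fin p} {e : Item} {g g′ : Addr} {l : MTFLine}
                   (inv : MemInv (mem (conf t)) G)
                   (at-i : proc (conf t) i ≡ searching e g (moveToFront (just g′) l))
                   (announcer : ∀ {j a e} → A (mem (conf t)) j ≡ (a , just e) →
                                ∃[ g ] a ≡ just g × Announced t j e g) where
      private
        C = conf t
        m = mem C
        module S = Assertions t C G
        module I = MemInv inv

      Outcome : MTFLine → Memory → Set
      Outcome l′ m′ = ∃[ G′ ]
        let C′ = moved C i m′ (searching e g (moveToFront (just g′) l′)) in
        Change (_≡ g) C G C′ G′ × (∀ j → AStep t C C′ j) × Assertions.MTFInv (suc t) C′ G′ g′ l′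

      private
        awaits-nothing : ∀ {x} → ¬ Awaits x (proc C i)
        awaits-nothing aw with subst (Awaits _) at-i aw
        ... | ()

        heap-step : ∀ {l′ m′} → HeapStep (_≡ g) m G m′ →
                    let C′ = moved C i m′ (searching e g (moveToFront (just g′) l′)) in
                    (∀ j → AStep t C C′ j) →
                    (Change (_≡ g) C G C′ G → Assertions.MTFInv (suc t) C′ G g′ l′) → Outcome l′ m′
        heap-step hs steps k = G , ch , steps , k ch
          where ch = change-quiet inv (heapStep-inv inv hs) (heapStep-evolves inv hs) inj₁ awaits-nothing steps

        quiet-step : ∀ {l′ m′} → HeapStep (_≡ g) m G m′ → A m′ ≡ A m →
                     let C′ = moved C i m′ (searching e g (moveToFront (just g′) l′)) in
                     (Change (_≡ g) C G C′ G → Assertions.MTFInv (suc t) C′ G g′ l′) → Outcome l′ m′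
        quiet-step hs A≡ = heap-step hs (λ j → inj₁ (cong (λ a → a j) A≡))

        read : ∀ {l′} → S.MTFInv g′ l′ → Outcome l′ m
        read {l′} mi = quiet-step (heap-same refl refl λ x∈ → x∈) refl
          λ ch → Stability.mtfInv ch l′ mi

        forEach-inv : ∀ {f h′ e′} js → S.Looping f h′ e′ js → S.MTFInv g′ (forEach f h′ e′ js)
        forEach-inv []       (hp , _ , s) = hp , s
        forEach-inv (j ∷ js) lp           = lp

        replaced : ∀ {f h′} → f ∈ hist G → old (heap m f) ≡ ptr h′ → ∃[ h ] h′ ≡ just h × OldIs m G f h
        replaced f∈ eq with I.undone-replacing f∈ (λ d → case trans (sym eq) d of λ ())
        ... | h , r with trans (sym eq) (Replacing.old≡ r)
        ...   | refl = h , refl , inj₁ eq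

        first≡ : ∀ {f h₂} → Head m ≡ (just f , h₂) → f ≡ I.front
        first≡ hd = just-injective (cong proj₁ (trans (sym hd) I.Head≡))

        -- Bypassing `h` can lose only `h` itself, which is retired. Every other target covered by a
        -- link to `h` ranks strictly below `h` and is covered by the link of `h`.
        link-through : ∀ {x h y} → h ∈ hist G → h ∈ ret G → GoodLink m G x (just h) →
                       GoodLink m G h y → GoodLink m G x y
        link-through {h = h} h∈ h∈r xh hy = record
          { settled = settled hy ; covers = λ v∈ v∉ v<x → beyond v∈ v∉ (covers xh v∈ v∉ v<x) }
          where
          beyond : ∀ {v} → v ∈ hist G → v ∉ ret G →
                   MaybeAny.Any (λ z → rank (hist G) v ≤ rank (hist G) z) (just h) →
                   MaybeAny.Any (λ z → rank (hist G) v ≤ rank (hist G) z) _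
          beyond v∈ v∉ (MaybeAny.just v≤h) = covers hy v∈ v∉
            (≤∧≢⇒< v≤h λ eq → ∉⇒≢ h∈r v∉ (sym (rank-injective (hist G) v∈ h∈ eq)))

        linkNext-step : ∀ {f h₂} → f ∈ hist G → GoodLink m G f h₂ →
                        HeapStep (_≡ g) m G (casNext f nothing h₂ m)
        linkNext-step {f} {h₂} f∈ gl = modify-step f (λ n → record n { next = cas _≟ᴾ_ nothing h₂ (next n) })
          (λ _ → record
            { item-step = refl ; next-step = next-step (next (heap m f) ≟ᴾ nothing)
            ; old-step = same refl ; new-step = same refl })
          (λ _ f∉ → ⊥-elim (f∉ (I.hist⊆pub f∈)))
          where
          next-step : Dec (next (heap m f) ≡ nothing) →
                      cas _≟ᴾ_ nothing h₂ (next (heap m f)) ≡ next (heap m f)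
                      ⊎ (f ∈ hist G × GoodLink m G f (cas _≟ᴾ_ nothing h₂ (next (heap m f))))
          next-step (no  n≢) = inj₁ (cas-miss _≟ᴾ_ n≢)
          next-step (yes n≡) = inj₂ (f∈ , subst (GoodLink m G f) (sym (cas-hit _≟ᴾ_ n≡)) gl)

        -- Both `pred` and `y` may be out of date. This does no harm: if the CAS succeeds on a
        -- listed node, its next field pointed to the retired `h`, and `y` has remained a good link
        -- from `h` since it was read.
        unlinkNext-step : ∀ {f h y pred} → S.Retired f h → GoodLink m G h y →
                          HeapStep (_≡ g) m G (casNext pred (just h) y m)
        unlinkNext-step {f} {h} {y} {pred} (_ , _ , _ , h∈r) gl =
          modify-step pred (λ n → record n { next = cas _≟ᴾ_ (just h) y (next n) }) (λ pred∈ → record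
            { item-step = refl
            ; next-step = next-step pred∈ (next (heap m pred) ≟ᴾ just h) (pred ∈? hist G)
            ; old-step = same refl ; new-step = same refl })
          (λ _ _ → record { item≡ = refl ; old≡ = refl ; new≡ = refl
                          ; next≡ = λ n≡ → trans
                              (cas-miss _≟ᴾ_ {just h} {y} λ eq → case trans (sym n≡) eq of λ ()) n≡ })
          where
          next-step : pred ∈ pub G → Dec (next (heap m pred) ≡ just h) → Dec (pred ∈ hist G) →
                      cas _≟ᴾ_ (just h) y (next (heap m pred)) ≡ next (heap m pred)
                      ⊎ (pred ∈ hist G × GoodLink m G pred (cas _≟ᴾ_ (just h) y (next (heap m pred))))
          next-step _ (no  n≢) _ = inj₁ (cas-miss _≟ᴾ_ n≢)
          next-step pred∈ (yes n≡) (no pred∉) =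
            case trans (sym n≡) (proj₁ (I.unlisted pred∈ pred∉)) of λ ()
          next-step _ (yes n≡) (yes pred∈) with I.linked pred∈
          ... | inj₂ (n≡′ , _) = case trans (sym n≡) n≡′ of λ ()
          ... | inj₁ l = inj₂ (pred∈ , subst (GoodLink m G pred) (sym (cas-hit _≟ᴾ_ n≡))
                  (link-through (proj₁ (I.ret-settled h∈r)) h∈r (subst (GoodLink m G pred) n≡ l) gl))

        casPrev-step : ∀ {a x y} → HeapStep (_≡ g) m G (casPrev a x y m)
        casPrev-step {a} {x} {y} = modify-step a (λ n → record n { prev = cas _≟ᴾ_ x y (prev n) })
          (λ _ → record { item-step = refl ; next-step = inj₁ refl ; old-step = same refl ; new-step = same refl })
          (λ _ _ → record { item≡ = refl ; old≡ = refl ; new≡ = refl ; next≡ = λ eq → eq })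

        markGone-step : ∀ {f h} → S.Retired f h → HeapStep (_≡ g) m G (casNew h (ptr (just f)) GONE m)
        markGone-step {f} {h} (f∈ , _ , _ , h∈r) =
          modify-step h (λ n → record n { new = cas _≟ᴺ_ (ptr (just f)) GONE (new n) }) (λ _ → record
            { item-step = refl ; next-step = inj₁ refl ; old-step = same refl
            ; new-step = new-step (new (heap m h) ≟ᴺ ptr (just f)) })
          (λ _ h∉ → ⊥-elim (h∉ (I.hist⊆pub (proj₁ (I.ret-settled h∈r)))))
          where
          new-step : Dec (new (heap m h) ≡ ptr (just f)) →
                     NewStep (_≡ g) m G h (cas _≟ᴺ_ (ptr (just f)) GONE (new (heap m h)))
          new-step (yes eq) = vanish (cas-hit _≟ᴺ_ eq) eq f∈ h∈r
          new-step (no  eq) = same (cas-miss _≟ᴺ_ eq)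

        markDone-step : ∀ {f h} → S.Retired f h → HeapStep (_≡ g) m G (casOld f (ptr (just h)) DONE m)
        markDone-step {f} {h} (f∈ , l , _ , h∈r) =
          modify-step f (λ n → record n { old = cas _≟ᴼ_ (ptr (just h)) DONE (old n) }) (λ _ → record
            { item-step = refl ; next-step = inj₁ refl
            ; old-step = old-step (old (heap m f) ≟ᴼ ptr (just h)) ; new-step = same refl })
          (λ _ f∉ → ⊥-elim (f∉ (I.hist⊆pub f∈)))
          where
          old-step : Dec (old (heap m f) ≡ ptr (just h)) →
                     OldStep (_≡ g) m G f (cas _≟ᴼ_ (ptr (just h)) DONE (old (heap m f)))
          old-step (yes eq) = finish (cas-hit _≟ᴼ_ eq) f∈ eq h∈r l
          old-step (no  eq) = same (cas-miss _≟ᴼ_ eq)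

        push : ∀ {f h₂} → S.MTFInv g′ (moveHead f h₂) → ∃[ h ] S.CopyOf g′ h →
               Outcome testDone (casHead (just f , h₂) (just g′ , just f) m)
        push {f} {h₂} (f-settled , unlisted) (h , h∈ , _ , _ , new≡)
          with Product.≡-dec _≟ᴾ_ _≟ᴾ_ (Head m) (just f , h₂)
        ... | no hd≢ = quiet-step (heap-same refl (cas-miss (Product.≡-dec _≟ᴾ_ _≟ᴾ_) hd≢) λ x∈ → x∈) refl λ _ → tt
        ... | yes hd≡ with first≡ hd≡ | new≡
        -- A new field that is `GONE` would mean that `g′` is listed, which the unchanged `Head`
        -- rules out.
        ...   | refl | inj₂ (_ , g∈) = ⊥-elim (unlisted hd≡ g∈)
        ...   | refl | inj₁ n≡ =
          P.G′ , change-quiet {t = t} inv P.push-inv P.push-evolves inj₁ awaits-nothing (λ _ → inj₁ refl)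
               , (λ _ → inj₁ refl) , tt
          where module P = Push inv (cas-hit (Product.≡-dec _≟ᴾ_ _≟ᴾ_) hd≡) (proj₂ f-settled) (unlisted hd≡) h∈ n≡

        notify-step : ∀ {f h′ e′ j js ab} → S.MTFInv g′ (notify f h′ e′ j js ab) →
                      Outcome (forEach f h′ e′ js) (casA j ab (just f , nothing) m)
        notify-step {f} {h′} {e′} {j} {js} {ab} (lp@((f∈ , _) , e≡ , s) , (a , ab≡ , an , pend) , w) =
          heap-step (heap-same refl refl λ x∈ → x∈) steps local
          where
          l′ = forEach f h′ e′ js
          C′ = moved C i (casA j ab (just f , nothing) m) (searching e g (moveToFront (just g′) l′))
          hit : A m j ≡ ab → A (mem C′) j ≡ (just f , nothing)
          hit eq = trans (updateAt-updates j (A m)) (cas-hit _≟ᴬ_ eq)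
          steps : ∀ k → AStep t C C′ k
          steps k with k Fin.≟ j
          ... | no  k≢j = inj₁ (updateAt-minimal k j (A m) k≢j)
          ... | yes refl with A m j ≟ᴬ ab
          ...   | no  A≢ = inj₁ (trans (updateAt-updates j (A m)) (cas-miss _≟ᴬ_ A≢))
          ...   | yes A≡ = inj₂ (a , e′ , f , trans A≡ ab≡ , hit A≡
                                , subst (_∈ items) (sym e≡) (I.item∈items f∈) , w ab≡)
          local : Change (_≡ g) C G C′ G → Assertions.MTFInv (suc t) C′ G g′ l′
          local ch = forEach′ js (St.helping (proj₁ lp)) (trans e≡ (sym (St.item-hist f∈))) safe-but
            where
            module St = Stability {t = t} ch
            module S′ = Assertions (suc t) C′ G
            safe-j : old (heap m f) ≢ DONE → Safe C′ f j
            safe-j ¬d with A m j ≟ᴬ ab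
            ... | yes A≡ = λ a≡ → case trans (sym (hit A≡)) a≡ of λ ()
            ... | no  A≢ with pend ¬d
            ...   | inj₁ A≡ = ⊥-elim (A≢ A≡)
            ...   | inj₂ sf = Change.safe ch j f∈ ¬d sf
            safe-but : S′.AllSafeBut f js
            safe-but ¬d k with s ¬d k
            ... | inj₁ (here refl) = inj₂ (safe-j ¬d)
            ... | inj₁ (there k∈)  = inj₁ k∈
            ... | inj₂ sf          = inj₂ (Change.safe ch k f∈ ¬d sf)
            forEach′ : ∀ js → S′.Helping f h′ → e′ ≡ item (heap m f) → S′.AllSafeBut f js →
                       S′.MTFInv g′ (forEach f h′ e′ js)
            forEach′ []       hp _  sb = hp , sb
            forEach′ (j ∷ js) hp eq sb = hp , eq , sb

        -- The first access after the notification loop is the earliest at which all indices have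
        -- been handled. Several helpers may pass here before completion, each retiring `h` anew;
        -- one that arrives later finds `h` retired through `OldIs`, and could not appeal to safety
        -- any more.
        retire : ∀ {f h pred} → S.MTFInv g′ (readPrev f (just h)) → Outcome (readNext f h pred) m
        retire ((f∈ , l , h , refl , inj₂ (d , h∈r)) , s) = read (f∈ , l , inj₂ (d , h∈r) , h∈r)
        retire {f} {h} {pred} ((f∈ , l , _ , refl , inj₁ o) , s) = R.G′ , ch , (λ _ → inj₁ refl)
          , (f∈ , Evolves.link (Change.evolves ch) f∈ l , inj₁ o , here refl)
          where
          module R = Retire inv f∈ o
          all-safe : ∀ j → Safe C f j
          all-safe j with s (λ d → case trans (sym o) d of λ ()) j
          ... | inj₂ sf = sf
          ret-step : ∀ {x} → x ∈ ret R.G′ → x ∈ ret G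
                   ⊎ ∃[ f ] f ∈ hist G × item (heap m f) ≡ item (heap m x) × (∀ j → Safe C f j)
          ret-step (here refl) = inj₂ (f , f∈ , sym R.replaced-item , all-safe)
          ret-step (there x∈)  = inj₁ x∈
          ch : Change (_≡ g) C G (moved C i m (searching e g (moveToFront (just g′) (readNext f h pred)))) R.G′
          ch = change-quiet {t = t} inv R.retire-inv R.retire-evolves ret-step awaits-nothing (λ _ → inj₁ refl)

      mtf-step : ∀ {l′ m′} → ∃[ h ] S.CopyOf g′ h → S.MTFInv g′ l → MTFStep g′ l m l′ m′ → Outcome l′ m′
      mtf-step cp mi (testDone _) = read tt
      mtf-step cp mi (readHead hd) with trans (sym hd) I.Head≡
      ... | refl = read (I.front , refl , I.front∈ , second-link inv)
      mtf-step cp (f , refl , f∈ , gl) (readOld-done d) = read (f∈ , d)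
      mtf-step cp (f , refl , f∈ , gl) (readOld-ptr o) = read (f∈ , gl , replaced f∈ o)
      mtf-step cp mi (retestDone-yes _) = read tt
      -- A listed `g′` that is not `DONE` would be the front; but if `Head` still shows `f`, the
      -- front is `f`, which is `DONE`.
      mtf-step cp f-settled (retestDone-no ¬d) = read (f-settled , λ hd g∈ →
        ¬d (subst (λ x → old (heap m x) ≡ DONE) (trans (first≡ hd) (sym (I.undone⇒front g∈ ¬d))) (proj₂ f-settled)))
      mtf-step cp mi moveHead = push mi cp
      mtf-step cp (f∈ , gl , h , h′≡ , o) (linkNext {h₁ = f} {h₂}) =
        quiet-step (linkNext-step f∈ gl) refl λ ch →
          let module Ev = Evolves (Change.evolves ch) in
          f∈ , linked′ Ev.link Ev.goodLink (next (heap m f) ≟ᴾ nothing) , h , h′≡ , Ev.old-is (I.hist⊆pub f∈) o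
        where
        m′ = casNext f nothing h₂ m
        linked′ : (∀ {x} → x ∈ hist G → Linked m G x → Linked m′ G x) →
                  (∀ {x y} → x ∈ hist G → GoodLink m G x y → GoodLink m′ G x y) →
                  Dec (next (heap m f) ≡ nothing) → Linked m′ G f
        linked′ link goodLink (yes n≡) = subst (GoodLink m′ G f)
          (sym (trans (cong next (modify-hit {f} {λ n → record n { next = cas _≟ᴾ_ nothing h₂ (next n) }} {m}))
                      (cas-hit _≟ᴾ_ n≡)))
          (goodLink f∈ gl)
        -- A field that is no longer NULL was filled earlier, so the exception in `linked` is ruled
        -- out and the invariant supplies the link.
        linked′ link goodLink (no n≢) with I.linked f∈
        ... | inj₁ l        = link f∈ l
        ... | inj₂ (n≡ , _) = ⊥-elim (n≢ n≡)
      mtf-step cp hp (linkPrev {h₁ = f} {h′ = h′}) =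
        quiet-step casPrev-step refl λ ch → Stability.mtfInv {t = t} ch {g′} (readItem f h′) hp
      mtf-step cp hp (readItem refl) = read (forEach-inv (allFin p) (hp , refl , λ _ j → inj₁ (∈-allFin j)))
      mtf-step cp lp (readA-same {a = a} eq) with announcer eq
      ... | _ , refl , an = read (lp , _ , refl , an , λ _ → inj₁ eq)
      mtf-step cp (hp , refl , s) (readA-other {h₁ = f} {j = j} {js} eq b≢) =
        read (forEach-inv js (hp , refl , λ ¬d k → skip (s ¬d k)))
        where
        skip : ∀ {k} → k ∈ j ∷ js ⊎ Safe C f k → k ∈ js ⊎ Safe C f k
        skip (inj₁ (here refl)) = inj₂ λ a≡ → ⊥-elim (b≢ (cong proj₂ (trans (sym eq) a≡)))
        skip (inj₁ (there k∈))  = inj₁ k∈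
        skip (inj₂ sf)          = inj₂ sf
      mtf-step cp ((hp , e≡ , s) , _) (testOld-done {js = js} d) =
        read (forEach-inv js (hp , e≡ , λ ¬d → ⊥-elim (¬d d)))
      mtf-step cp (lp@((f∈ , _) , e≡ , _) , rb@(a , ab≡ , an , _)) (testOld-ptr {h₁ = f} {e′ = e′} {j = j} {ab = ab} ¬d) =
        read (lp , rb , λ {a} → was-front {a})
        where
        was-front : ∀ {a} → ab ≡ (just a , just e′) → WasFront t j e′ a f
        was-front eq with trans (sym eq) ab≡
        ... | refl = t , ≤-refl , an
                   , trans (cong proj₁ I.Head≡) (cong just (sym (I.undone⇒front f∈ ¬d))) , sym e≡
      mtf-step cp mi notify = notify-step mi
      mtf-step cp mi (readPrev _) = retire mi
      mtf-step cp r@(_ , _ , _ , h∈r) (readNext refl) with I.ret-settled h∈r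
      ... | h∈ , d with I.linked h∈
      ...   | inj₁ l        = read (r , l)
      ...   | inj₂ (_ , ¬d) = ⊥-elim (¬d d)
      mtf-step cp (r , gl) (unlinkNext {succ = nothing}) =
        quiet-step (unlinkNext-step r gl) refl λ ch → Stability.retired {t = t} ch r
      mtf-step cp (r , gl) (unlinkNext {succ = just _}) =
        quiet-step (unlinkNext-step r gl) refl λ ch → Stability.retired {t = t} ch r
      mtf-step cp r unlinkPrev = quiet-step casPrev-step refl λ ch → Stability.retired {t = t} ch r
      mtf-step cp r markGone = quiet-step (markGone-step r) refl λ ch → Stability.retired {t = t} ch r
      mtf-step cp r markDone = quiet-step (markDone-step r) refl λ _ → tt

    -- The global invariant, and ownership of nodes.

    record Inv (t : ℕ) (C : Config) (G : Ghost) : Set where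
      field
        mem-inv  : MemInv (mem C) G
        procs    : ∀ i → Assertions.ProcInv t C G i (proc C i)
        distinct : ∀ {i j g} → nodeOf (proc C i) ≡ just g → nodeOf (proc C j) ≡ just g → i ≡ j

    module _ {t : ℕ} {C : Config} {G : Ghost} where
      open Assertions t C G

      standing : ∀ {i e g} l → LineInv i e g l →
                 Private i g ⊎ Active i e g ⊎ (g ∈ pub G × A (mem C) i ≡ (nothing , nothing))
      standing writeItem pr = inj₁ pr
      standing writePrev (pr , _) = inj₁ pr
      standing writeNext (pr , _) = inj₁ pr
      standing writeOld (pr , _) = inj₁ pr
      standing writeNew (pr , _) = inj₁ pr
      standing announce (pr , _) = inj₁ pr
      standing readHead (act , _) = inj₂ (inj₁ act)
      standing (compareFirst h₁ h) (act , _) = inj₂ (inj₁ act)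
      standing (withdraw h₁) (act , _) = inj₂ (inj₁ act)
      standing (compareItem h c) (act , _) = inj₂ (inj₁ act)
      standing (checkAtItem h) (act , _) = inj₂ (inj₁ act)
      standing (setOld h) (act , _) = inj₂ (inj₁ act)
      standing (setNew h) (act , _) = inj₂ (inj₁ act)
      standing (readNew h) (act , _) = inj₂ (inj₁ act)
      standing (moveToFront nothing l) act = inj₂ (inj₁ act)
      standing (moveToFront (just g′) l) (act , _) = inj₂ (inj₁ act)
      standing readResult (act , _) = inj₂ (inj₁ act)
      standing (checkPeriod h c) (act , _) = inj₂ (inj₁ act)
      standing (advance h c) (act , _) = inj₂ (inj₁ act)
      standing checkAtEnd (act , _) = inj₂ (inj₁ act)
      standing (clear ab r) (act , _) = inj₂ (inj₁ act)
      standing (returning r) (g∈ , a≡ , _) = inj₂ (inj₂ (g∈ , a≡))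

      -- An item gets into `A j` only through `j` itself, and the assertion of `j` fixes the value
      -- at every line. Hence a helper that reads an item there also learns to which search it
      -- belongs.
      announcer : Inv t C G → ∀ {j a e} → A (mem C) j ≡ (a , just e) →
                  ∃[ g ] a ≡ just g × Announced t j e g
      announcer inv {j} {a} {e} eq = go (proc C j) (Inv.procs inv j)
        where
        not-NULL : {X : Set} → A (mem C) j ≡ (nothing , nothing) → X
        not-NULL eq′ = case trans (sym eq) eq′ of λ ()
        go : ∀ ps → ProcInv j ps → ∃[ g ] a ≡ just g × Announced t j e g
        go idle eq′ = not-NULL eq′
        go (allocating _) eq′ = not-NULL eq′
        go (searching e′ g l) li with standing l li
        ... | inj₁ (_ , _ , eq′) = not-NULL eq′
        ... | inj₂ (inj₂ (_ , eq′)) = not-NULL eq′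
        ... | inj₂ (inj₁ act) with Active.A-value act
        ...   | inj₂ (_ , eq′ , _) = case trans (sym eq) eq′ of λ ()
        ...   | inj₁ u with trans (sym eq) u
        ...     | refl = g , refl , Active.announced act

      node-allocated : Inv t C G → ∀ {j g} → nodeOf (proc C j) ≡ just g → g ∈ allocated (mem C)
      node-allocated inv {j} {g} = go (proc C j) (Inv.procs inv j)
        where
        pub⊆ = MemInv.pub⊆alloc (Inv.mem-inv inv)
        go : ∀ ps → ProcInv j ps → nodeOf ps ≡ just g → g ∈ allocated (mem C)
        go (searching _ _ l) li refl with standing l li
        ... | inj₁ (g∈ , _) = g∈
        ... | inj₂ (inj₁ act) = pub⊆ (Active.g∈pub act)
        ... | inj₂ (inj₂ (g∈ , _)) = pub⊆ g∈

      preserved : ∀ {N : Addr → Set} {i m′ ps ps′ G′} → Inv t C G → proc C i ≡ ps →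
        Change N C G (moved C i m′ ps′) G′ →
        (∀ j → j ≢ i → AStep t C (moved C i m′ ps′) j) →
        (∀ {x} → N x → nodeOf ps ≡ just x) →
        (∀ {g} → nodeOf ps′ ≡ just g → nodeOf ps ≡ just g ⊎ g ∉ allocated (mem C)) →
        Assertions.ProcInv (suc t) (moved C i m′ ps′) G′ i ps′ →
        Inv (suc t) (moved C i m′ ps′) G′
      preserved {N} {i} {m′} {ps} {ps′} {G′} inv refl ch others own node inv-i = record
        { mem-inv = Change.inv′ ch ; procs = procs′ ; distinct = distinct′ }
        where
        C′ = moved C i m′ ps′
        proc-i : proc C′ i ≡ ps′
        proc-i = updateAt-updates i (proc C)
        proc-other : ∀ {j} → j ≢ i → proc C′ j ≡ proc C j
        proc-other {j} j≢i = updateAt-minimal j i (proc C) j≢i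
        procs′ : ∀ j → Assertions.ProcInv (suc t) C′ G′ j (proc C′ j)
        procs′ j with j Fin.≟ i
        ... | yes refl = subst (Assertions.ProcInv (suc t) C′ G′ j) (sym proc-i) inv-i
        ... | no  j≢i  = subst (Assertions.ProcInv (suc t) C′ G′ j) (sym (proc-other j≢i))
          (Stability.procInv ch (proc C j) (λ n Ng → j≢i (Inv.distinct inv n (own Ng)))
            (others j j≢i) refl (Inv.procs inv j))
        clash : ∀ {j g} → j ≢ i → nodeOf (proc C j) ≡ just g → nodeOf ps′ ≡ just g → j ≡ i
        clash j≢i n n′ with node n′
        ... | inj₁ n-i = Inv.distinct inv n n-i
        ... | inj₂ g∉  = ⊥-elim (g∉ (node-allocated inv n))
        distinct′ : ∀ {j k g} → nodeOf (proc C′ j) ≡ just g → nodeOf (proc C′ k) ≡ just g → j ≡ k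
        distinct′ {j} {k} nj nk with j Fin.≟ i | k Fin.≟ i
        ... | yes refl | yes refl = refl
        ... | no  j≢i  | no  k≢i  =
          Inv.distinct inv (trans (cong nodeOf (sym (proc-other j≢i))) nj)
                           (trans (cong nodeOf (sym (proc-other k≢i))) nk)
        ... | no  j≢i  | yes refl =
          clash j≢i (trans (cong nodeOf (sym (proc-other j≢i))) nj) (trans (cong nodeOf (sym proc-i)) nk)
        ... | yes refl | no  k≢i  =
          sym (clash k≢i (trans (cong nodeOf (sym (proc-other k≢i))) nk) (trans (cong nodeOf (sym proc-i)) nj))

    -- Preservation by the steps of SEARCH.

    module SearchPreservation {t : ℕ} {G : Ghost} {i : Fin p} {e : Item} {g : Addr} {l : Line}
                   (inv : Inv t (conf t) G) (ev : event t ≡ access i)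
                   (at-i : proc (conf t) i ≡ searching e g l) where
      private
        C = conf t
        m = mem C
        module S = Assertions t C G
        module I = MemInv (Inv.mem-inv inv)
        mem-inv = Inv.mem-inv inv

      Outcome : Line → Memory → Set
      Outcome l′ m′ = ∃[ G′ ]
        let C′ = moved C i m′ (searching e g l′) in
        Change (_≡ g) C G C′ G′ × (∀ j → j ≢ i → AStep t C C′ j) × Assertions.LineInv (suc t) C′ G′ i e g l′

      private
        awaits-line : ∀ {x} → Awaits x (proc C i) → Awaits x (searching e g l)
        awaits-line = subst (Awaits _) at-i

        quiet : (∀ {x} → ¬ Awaits x (searching e g l)) → ∀ {x} → ¬ Awaits x (proc C i)
        quiet ¬a aw = ¬a (awaits-line aw)

        proc-i : ∀ {ps} → updateAt (proc C) i (λ _ → ps) i ≡ ps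
        proc-i = updateAt-updates i (proc C)

        heap-step : ∀ {l′ m′} → (∀ {x} → ¬ Awaits x (searching e g l)) →
          HeapStep (_≡ g) m G m′ → A m′ ≡ A m →
          (Change (_≡ g) C G (moved C i m′ (searching e g l′)) G →
            Assertions.LineInv (suc t) (moved C i m′ (searching e g l′)) G i e g l′) →
          Outcome l′ m′
        heap-step ¬a hs A≡ k = G , ch , (λ j _ → inj₁ (cong (λ a → a j) A≡)) , k ch
          where ch = change-quiet {t = t} mem-inv (heapStep-inv mem-inv hs) (heapStep-evolves mem-inv hs) inj₁
                       (quiet ¬a) (λ j → inj₁ (cong (λ a → a j) A≡))

        no-effect : HeapStep (_≡ g) m G m
        no-effect = heap-same refl refl λ x∈ → x∈

        read-inv = heapStep-inv mem-inv no-effect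
        read-evolves = heapStep-evolves mem-inv no-effect

        active⁺ : ∀ {l′} → S.Active i e g → Assertions.Active (suc t) (moved C i m (searching e g l′)) G i e g
        active⁺ act = record
          { g∈pub = g∈pub ; item≡ = item≡ ; announced = announced⁺ announced ; A-value = A⁺ A-value }
          where
          open S.Active act
          A⁺ : S.Unnotified i e g ⊎ ∃[ v ] A m i ≡ (just v , nothing) × e ∈ items × WasFront t i e g v →
               S.Unnotified i e g ⊎ ∃[ v ] A m i ≡ (just v , nothing) × e ∈ items × WasFront (suc t) i e g v
          A⁺ (inj₁ u) = inj₁ u
          A⁺ (inj₂ (v , eq , e∈ , w)) = inj₂ (v , eq , e∈ , wasFront⁺ w)

        read : ∀ {l′} → (∀ {x} → ¬ Awaits x (searching e g l)) →
               Assertions.LineInv (suc t) (moved C i m (searching e g l′)) G i e g l′ → Outcome l′ m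
        read ¬a li = heap-step ¬a no-effect refl λ _ → li

        write-own : ∀ {l′} f → (∀ {x} → ¬ Awaits x (searching e g l)) → g ∉ pub G →
          (heap (modify g f m) g ≡ f (heap m g) →
            Assertions.LineInv (suc t) (moved C i (modify g f m) (searching e g l′)) G i e g l′) →
          Outcome l′ (modify g f m)
        write-own f ¬a g∉ li = heap-step ¬a
          (modify-step g f (λ g∈ → ⊥-elim (g∉ g∈)) (λ ¬N _ → ⊥-elim (¬N refl))) refl
          λ _ → li (modify-hit {g} {f} {m})

        notified-result : ∀ {a} → S.Active i e g → A m i ≡ (a , nothing) →
          ∀ {l′} → let module S′ = Assertions (suc t) (moved C i m (searching e g l′)) G in
          S′.LineInv i e g (clear (a , nothing) (found a))
        notified-result act eq with S.Active.A-value act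
        ... | inj₁ u = case trans (sym u) eq of λ ()
        ... | inj₂ (v , eq′ , e∈ , w) with trans (sym eq) eq′
        ...   | refl = active⁺ act , (λ _ u → case trans (sym eq) u of λ ()) , eq
                     , (λ _ → v , refl , wasFront⁺ w) , λ e∉ → ⊥-elim (e∉ e∈)

        others-same : ∀ x y ps j → j ≢ i → AStep t C (moved C i (casA i x y m) ps) j
        others-same x y ps j j≢i = inj₁ (updateAt-minimal j i (A m) j≢i)

        -- Notification loops that have passed index `i` miss this announcement. They may: the
        -- search has yet to read `Head` and counts as safe for every node until then.
        announce-step : l ≡ announce → S.LineInv i e g announce →
                        Outcome readHead (casA i (nothing , nothing) (just g , just e) m)
        announce-step refl ((g∈ , g∉ , a≡) , i≡ , n≡ , o≡ , w≡) =
          An.G′ , change {t = t} mem-inv An.announce-inv An.announce-evolves inj₁ others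
                    (inj₂ (λ _ → awaiting)) (λ _ _ _ → awaiting)
          , others
          , record { g∈pub = here refl ; item≡ = i≡ ; announced = t , ≤-refl , ev , at-i
                   ; A-value = inj₁ (trans (updateAt-updates i (A m)) (cas-hit _≟ᴬ_ a≡)) }
          , An.announce-unpublished , o≡
          where
          module An = Announce mem-inv g∈ g∉ n≡ w≡
          C′ = moved C i (casA i (nothing , nothing) (just g , just e) m) (searching e g readHead)
          others : ∀ j → j ≢ i → AStep t C C′ j
          others = others-same (nothing , nothing) (just g , just e) (searching e g readHead)
          awaiting : ∀ {x} → Safe C′ x i
          awaiting _ = subst (Awaits _) (sym proc-i) at-readHead

        readHead-step : ∀ {h₁ h} → l ≡ readHead → S.LineInv i e g readHead → Head m ≡ (h₁ , h) →
                        Outcome (compareFirst h₁ h) m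
        readHead-step refl (act , fr) hd with trans (sym hd) I.Head≡
        ... | refl = G , change {t = t} mem-inv read-inv read-evolves inj₁ (λ _ _ → inj₁ refl) (inj₁ refl) self-safe
          , (λ _ _ → inj₁ refl)
          , active⁺ act , fr , I.front , refl , I.front∈
          , (λ i≡ → t , ≤-refl , ev , at-i , S.Active.announced act , cong proj₁ hd , i≡)
          , λ i≢ → I.second , refl , (I.second∈ , I.second-done) , λ _ e∈ → target i≢ e∈
          where
          self-safe : ∀ {x} → x ∈ hist G → old (heap m x) ≢ DONE → Safe C x i →
                      Safe (moved C i m (searching e g (compareFirst (just I.front) (just I.second)))) x i
          -- Safety is required only for an undone `x`; that is the front, the very node read here.
          self-safe x∈ ¬d _ _ with I.undone⇒front x∈ ¬d
          ... | refl = subst (Awaits _) (sym proc-i) at-compare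
          target : item (heap m I.front) ≢ e → e ∈ items →
                   ∃[ v ] v ∈ hist G × v ∉ ret G × item (heap m v) ≡ e × rank (hist G) v ≤ rank (hist G) I.second
          target i≢ e∈ with I.live-copy e∈
          -- The live copy is not the front, whose item differs, so it ranks below the front and the
          -- second node does not skip it.
          ... | v , v∈ , v∉ , i≡ with covers (second-link mem-inv) v∈ v∉
                    (subst (λ h → rank h v < rank h I.front) (sym I.hist≡)
                      (rank<head {x = v} (I.second ∷ I.rest) λ { refl → i≢ i≡ }))
          ...   | MaybeAny.just v≤s = v , v∈ , v∉ , i≡ , v≤s

        first-matches : ∀ {f h} → l ≡ compareFirst (just f) h → S.LineInv i e g (compareFirst (just f) h) →
                        item (heap m f) ≡ e → Outcome (withdraw (just f)) m
        first-matches {f} refl (act , fr , _ , refl , f∈ , yes′ , _) i≡ =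
          G , change {t = t} mem-inv read-inv read-evolves inj₁ (λ _ _ → inj₁ refl) (inj₁ refl)
                (λ _ _ _ _ → subst (Awaits _) (sym proc-i) at-withdraw)
          , (λ _ _ → inj₁ refl)
          , active⁺ act , f , refl , f∈ , i≡ , headRead⁺ (yes′ i≡)

        first-differs : ∀ {f h} → l ≡ compareFirst (just f) h → S.LineInv i e g (compareFirst (just f) h) →
                        item (heap m f) ≢ e → Outcome (while h 0) m
        first-differs {f} refl (act , fr , _ , refl , f∈ , _ , no′) i≢ with no′ i≢
        ... | h , refl , tr =
          G , change {t = t} mem-inv read-inv read-evolves inj₁ (λ _ _ → inj₁ refl) (inj₁ refl) self-safe
          , (λ _ _ → inj₁ refl)
          , active⁺ act , fr , tr
          where
          self-safe : ∀ {x} → x ∈ hist G → old (heap m x) ≢ DONE → Safe C x i →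
                      Safe (moved C i m (searching e g (compareItem h 0))) x i
          -- The search stops awaiting `f`, but its safety never rested on that: it announces `e`,
          -- which is not the item of `f`.
          self-safe _ _ sf a≡ with awaits-line (sf a≡)
          ... | at-compare with S.Active.A-value act
          ...   | inj₁ u with trans (sym a≡) u
          ...     | refl = ⊥-elim (i≢ refl)
          self-safe _ _ sf a≡ | at-compare | inj₂ (_ , u , _) = case trans (sym a≡) u of λ ()

        own-CAS : ∀ {x y l′} →
          let C′ = moved C i (casA i x y m) (searching e g l′) in
          proj₂ (A (mem C′) i) ≡ nothing →
          (Change (_≡ g) C G C′ G → Assertions.LineInv (suc t) C′ G i e g l′) →
          Outcome l′ (casA i x y m)
        own-CAS {x} {y} {l′} none k = G , ch , others-same x y (searching e g l′) , k ch
          where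
          hs : HeapStep (_≡ g) m G (casA i x y m)
          hs = heap-same refl refl λ x∈ → x∈
          hs-inv = heapStep-inv mem-inv hs
          hs-evolves = heapStep-evolves mem-inv hs
          safe-i : ∀ {z} → Safe (moved C i (casA i x y m) (searching e g l′)) z i
          safe-i = notified-safe {t = t} {C} {i = i} {ps = searching e g l′} mem-inv hs-inv hs-evolves inj₁ none
          ch = change {t = t} mem-inv hs-inv hs-evolves inj₁ (others-same x y (searching e g l′))
            (inj₂ λ _ → safe-i) (λ _ _ _ → safe-i)

        head-result : ∀ {f} → f ∈ hist G → item (heap m f) ≡ e → HeadRead t i e g f →
                      ∀ {C′ G′} → Assertions.ResultOK (suc t) C′ G′ i e g (found (just f))
        head-result {f} f∈ i≡ (u , u<t , _ , _ , at) =
          (λ _ → f , refl , u , m≤n⇒m≤1+n (<⇒≤ u<t) , at) , λ e∉ → ⊥-elim (e∉ (subst (_∈ items) i≡ (I.item∈items f∈)))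

        -- A promised copy strictly behind `h` would be superseded by the settled `h` and hence
        -- retired, so that copy is `h` itself.
        caught-up : ∀ {h} → S.Traversing i e g h → item (heap m h) ≡ e → S.AtItem i e g h
        caught-up {h} ((h∈ , d) , target) i≡ = (h∈ , d) , i≡ , live
          where
          live : S.Unnotified i e g → h ∉ ret G
          live u with target u (subst (_∈ items) i≡ (I.item∈items h∈))
          ... | v , v∈ , v∉ , i≡′ , v≤h with rank (hist G) v ℕ.≟ rank (hist G) h
          ...   | yes r≡ = subst (_∉ ret G) (rank-injective (hist G) v∈ h∈ r≡) v∉
          ...   | no  r≢ = ⊥-elim (v∉ (I.superseded h∈ v∈ (≤∧≢⇒< v≤h r≢) (trans i≡ (sym i≡′)) d))

        -- The node `h` is not the promised copy, since its item differs, so the copy ranks strictly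
        -- below it and the link has to cover it. In particular `y` is not NULL, which is why an
        -- unnotified search for a present item never reaches the end of the list.
        target-beyond : ∀ {h y} → S.Traversing i e g h → item (heap m h) ≢ e → next (heap m h) ≡ y →
                        S.Unnotified i e g → e ∈ items →
                        ∃[ v ] v ∈ hist G × v ∉ ret G × item (heap m v) ≡ e
                             × MaybeAny.Any (λ z → rank (hist G) v ≤ rank (hist G) z) y
        target-beyond {h} ((h∈ , d) , target) i≢ refl u e∈ with target u e∈ | I.linked h∈
        ... | _ | inj₂ (_ , ¬d) = ⊥-elim (¬d d)
        ... | v , v∈ , v∉ , i≡ , v≤h | inj₁ l = v , v∈ , v∉ , i≡ , covers l v∈ v∉
          (≤∧≢⇒< v≤h λ r≡ → i≢ (subst (λ x → item (heap m x) ≡ e) (rank-injective (hist G) v∈ h∈ r≡) i≡))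

        advance-step : ∀ {h c} y → l ≡ advance h c → S.LineInv i e g (advance h c) → next (heap m h) ≡ y →
                       Outcome (while y c) m
        advance-step nothing refl (act , fr , tr , i≢) n≡ = read (λ ()) (active⁺ act , λ e∈ u →
          case proj₂ (proj₂ (proj₂ (proj₂ (target-beyond tr i≢ n≡ u e∈)))) of λ ())
        advance-step {h} (just y) refl (act , fr , tr , i≢) n≡ =
          read (λ ()) (active⁺ act , fr , y-settled (I.linked h∈) , target)
          where
          h∈ = proj₁ (proj₁ tr)
          y-settled : Linked m G h ⊎ (next (heap m h) ≡ nothing × old (heap m h) ≢ DONE) → Settled m G y
          y-settled (inj₂ (_ , ¬d)) = ⊥-elim (¬d (proj₂ (proj₁ tr)))
          y-settled (inj₁ l) with subst (MaybeAll.All (Settled m G)) n≡ (settled l)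
          ... | MaybeAll.just s = s
          target : S.Unnotified i e g → e ∈ items →
                   ∃[ v ] v ∈ hist G × v ∉ ret G × item (heap m v) ≡ e × rank (hist G) v ≤ rank (hist G) y
          target u e∈ with target-beyond tr i≢ n≡ u e∈
          ... | v , v∈ , v∉ , i≡ , MaybeAny.just v≤y = v , v∈ , v∉ , i≡ , v≤y

        -- The withdrawal came too late and its CAS fails. The node found at the front is returned
        -- all the same, so the correctness of the result rests on the read of `Head` and not on the
        -- notification.
        withdraw-notified : ∀ {h₁ a} → l ≡ withdraw h₁ → S.LineInv i e g (withdraw h₁) → A m i ≡ (a , nothing) →
          Outcome (clear (a , nothing) (found h₁)) (casA i (just g , just e) (nothing , nothing) m)
        withdraw-notified refl (act , f , refl , f∈ , i≡ , hr) a≡ = own-CAS (cong proj₂ a≡′) λ ch →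
          Stability.active ch (inj₁ (trans a≡′ (sym a≡))) act
          , (λ _ u → case trans (sym a≡′) u of λ ()) , a≡′ , head-result f∈ i≡ hr {C} {G}
          where
          a≡′ = trans (updateAt-updates i (A m))
                      (trans (cas-miss _≟ᴬ_ λ u → case trans (sym a≡) u of λ ()) a≡)

        withdraw-unnotified : ∀ {h₁ a b} → l ≡ withdraw h₁ → S.LineInv i e g (withdraw h₁) → A m i ≡ (a , just b) →
          Outcome (returning (found h₁)) (casA i (just g , just e) (nothing , nothing) m)
        withdraw-unnotified refl (act , f , refl , f∈ , i≡ , hr) a≡ with S.Active.A-value act
        ... | inj₂ (_ , eq , _) = case trans (sym a≡) eq of λ ()
        ... | inj₁ u = own-CAS (cong proj₂ a≡′) λ _ → S.Active.g∈pub act , a≡′ , head-result f∈ i≡ hr {C} {G}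
          where a≡′ = trans (updateAt-updates i (A m)) (cas-hit _≟ᴬ_ u)

        clear-step : ∀ {ab r} → l ≡ clear ab r → S.LineInv i e g (clear ab r) →
                     Outcome (returning r) (casA i ab (nothing , nothing) m)
        clear-step refl (act , _ , a≡ , ok) = own-CAS (cong proj₂ a≡′) λ _ →
          S.Active.g∈pub act , a≡′ , (λ e∈ → let (v , eq , w) = proj₁ ok e∈ in v , eq , wasFront⁺ w) , proj₂ ok
          where a≡′ = trans (updateAt-updates i (A m)) (cas-hit _≟ᴬ_ a≡)

        setOld-step : ∀ {h} → l ≡ setOld h → S.LineInv i e g (setOld h) →
                      Outcome (setNew h) (casOld g (ptr nothing) (ptr (just h)) m)
        setOld-step {h} refl (act , ((g∉ , u) , o≡) , at) = heap-step (λ ())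
          (modify-step g upd (λ _ → record { item-step = refl ; next-step = inj₁ refl
                                          ; old-step = set (cas-hit _≟ᴼ_ o≡) refl o≡ (g∉ , u) ; new-step = same refl })
            (λ ¬N _ → ⊥-elim (¬N refl)))
          refl λ ch → Stability.active ch (inj₁ refl) act
            , (g∉ , λ {y} y∈ eq → u y∈ (trans (sym (new-same y∈)) eq))
            , trans (cong old (modify-hit {g} {upd} {m})) (cas-hit _≟ᴼ_ o≡)
            , Stability.atItem {t = t} ch (inj₁ refl) (λ _ → quiet λ ()) at
          where
          upd : Node → Node
          upd n = record n { old = cas _≟ᴼ_ (ptr nothing) (ptr (just h)) (old n) }
          new-same : ∀ {y} → y ∈ hist G → new (heap (modify g upd m) y) ≡ new (heap m y)
          new-same {y} y∈ rewrite dec-false (y ℕ.≟ g) (∉⇒≢ y∈ g∉) = refl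

        setNew-step : ∀ {h} → l ≡ setNew h → S.LineInv i e g (setNew h) →
                      Outcome (readNew h) (casNew h (ptr nothing) (ptr (just g)) m)
        setNew-step {h} refl (act , (g∉ , u) , o≡ , at@((h∈ , d) , i≡ , _)) = heap-step (λ ())
          (modify-step h (λ n → record n { new = cas _≟ᴺ_ (ptr nothing) (ptr (just g)) (new n) })
            (λ _ → record { item-step = refl ; next-step = inj₁ refl ; old-step = same refl
                          ; new-step = new-step (new (heap m h) ≟ᴺ ptr nothing) })
            (λ _ h∉ → ⊥-elim (h∉ (I.hist⊆pub h∈))))
          refl λ ch → Stability.active ch (inj₁ refl) act
            , Stability.atItem {t = t} ch (inj₁ refl) (λ _ → quiet λ ()) at
          where
          new-step : Dec (new (heap m h) ≡ ptr nothing) →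
                     NewStep (_≡ g) m G h (cas _≟ᴺ_ (ptr nothing) (ptr (just g)) (new (heap m h)))
          new-step (no  eq) = same (cas-miss _≟ᴺ_ eq)
          new-step (yes eq) = publish (cas-hit _≟ᴺ_ eq) h∈ eq refl (S.Active.g∈pub act) g∉
            (trans (S.Active.item≡ act) (sym i≡)) o≡

        readNew-step : ∀ {h} g′ → l ≡ readNew h → S.LineInv i e g (readNew h) → new (heap m h) ≡ ptr g′ →
                       Outcome (moveToFront g′ testDone) m
        readNew-step nothing refl (act , _) _ = read (λ ()) (active⁺ act)
        readNew-step {h} (just g′) refl (act , at@((h∈ , _) , _)) n≡
          with subst (NewOK m G h) n≡ (I.new-ok h∈)
        ... | g∈ , _ , o , _ = read (λ ()) (active⁺ act , (h , at , h∈ , g∈ , o , inj₁ n≡) , tt)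

        mtf : ∀ {g′ k k′ m′} → l ≡ moveToFront (just g′) k → S.LineInv i e g (moveToFront (just g′) k) →
              MTFStep g′ k m k′ m′ → Outcome (moveToFront (just g′) k′) m′
        mtf refl (act , (h , at , cp) , mi) st
          with MTFPreservation.mtf-step mem-inv at-i (announcer inv) (h , cp) mi st
        ... | G′ , ch , steps , mi′ = G′ , ch , (λ j _ → steps j)
            , Stability.active ch (steps i) act
            , (h , Stability.atItem ch (steps i) (λ _ → quiet λ ()) at , Stability.copyOf {t = t} ch cp) , mi′

        mtf-exit : ∀ {g′} → l ≡ moveToFront (just g′) testDone →
                   S.LineInv i e g (moveToFront (just g′) testDone) → old (heap m g′) ≡ DONE → Outcome readResult m
        mtf-exit refl (act , (h , ((h∈ , _) , i≡ , live) , _ , _ , o , _) , _) d =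
          read (λ ()) (active⁺ act , subst (_∈ items) i≡ (I.item∈items h∈) , retired o)
          where
          retired : OldIs m G _ h → ¬ S.Unnotified i e g
          retired (inj₁ o≡) _ = case trans (sym o≡) d of λ ()
          retired (inj₂ (_ , h∈r)) u = live u h∈r

      search-step : ∀ {l′ m′} → S.LineInv i e g l → SearchStep i e g l m l′ m′ → Outcome l′ m′
      search-step (g∈ , g∉ , a≡) writeItem =
        write-own (λ n → record n { item = e }) (λ ()) g∉ λ own →
          (g∈ , g∉ , a≡) , cong item own
      search-step (pr@(_ , g∉ , _) , i≡) writePrev =
        write-own (λ n → record n { prev = nothing }) (λ ()) g∉ λ own →
          pr , trans (cong item own) i≡
      search-step (pr@(_ , g∉ , _) , i≡) writeNext =
        write-own (λ n → record n { next = nothing }) (λ ()) g∉ λ own →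
          pr , trans (cong item own) i≡ , cong next own
      search-step (pr@(_ , g∉ , _) , i≡ , n≡) writeOld =
        write-own (λ n → record n { old = ptr nothing }) (λ ()) g∉ λ own →
          pr , trans (cong item own) i≡ , trans (cong next own) n≡ , cong old own
      search-step (pr@(_ , g∉ , _) , i≡ , n≡ , o≡) writeNew =
        write-own (λ n → record n { new = ptr nothing }) (λ ()) g∉ λ own →
          pr , trans (cong item own) i≡ , trans (cong next own) n≡ , trans (cong old own) o≡ , cong new own
      search-step li announce = announce-step refl li
      search-step li (readHead hd) = readHead-step refl li hd
      search-step li (compareFirst-yes i≡) = first-matches refl li i≡
      search-step li (compareFirst-no i≢) = first-differs refl li i≢
      search-step li (withdraw-⊥ a≡) = withdraw-notified refl li a≡
      search-step li (withdraw-item a≡) = withdraw-unnotified refl li a≡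
      search-step (act , fr , tr) (compareItem-yes i≡) = read (λ ()) (active⁺ act , fr , caught-up tr i≡)
      search-step (act , fr , tr) (compareItem-check i≢ _) = read (λ ()) (active⁺ act , fr , tr , i≢)
      search-step (act , fr , tr) (compareItem-skip i≢ _) = read (λ ()) (active⁺ act , fr , tr , i≢)
      search-step (act , _) (checkAtItem-⊥ a≡) = read (λ ()) (notified-result act a≡)
      search-step (act , r) (checkAtItem-item _) = read (λ ()) (active⁺ act , r)
      search-step li setOld = setOld-step refl li
      search-step li setNew = setNew-step refl li
      search-step (act , ((h∈ , _) , i≡ , live)) (readNew-gone {h = h} n≡) = read (λ ())
        ( active⁺ act , subst (_∈ items) i≡ (I.item∈items h∈)
        , λ u → live u (subst (NewOK m G h) n≡ (I.new-ok h∈)))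
      search-step li (readNew-ptr n≡) = readNew-step _ refl li n≡
      search-step li (moveToFront st) = mtf refl li st
      search-step li (moveToFront-exit d) = mtf-exit refl li d
      search-step (act , e∈ , ¬u) (readResult a≡) with S.Active.A-value act
      ... | inj₁ u = ⊥-elim (¬u u)
      ... | inj₂ (v , eq , _) with trans (sym a≡) eq
      ...   | refl = read (λ ()) (notified-result act a≡)
      search-step (act , _) (checkPeriod-⊥ a≡) = read (λ ()) (notified-result act a≡)
      search-step (act , r) (checkPeriod-item _) = read (λ ()) (active⁺ act , r)
      search-step li (advance n≡) = advance-step _ refl li n≡
      search-step (act , _) (checkAtEnd-⊥ a≡) = read (λ ()) (notified-result act a≡)
      search-step (act , ¬u) (checkAtEnd-item a≡) = read (λ ())
        (active⁺ act , ¬u , a≡ , (λ e∈ → ⊥-elim (absurd e∈ (S.Active.A-value act))) , λ _ → refl)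
        where
        absurd : e ∈ items →
          S.Unnotified i e g ⊎ ∃[ v ] A m i ≡ (just v , nothing) × e ∈ items × WasFront t i e g v → ⊥
        absurd e∈ (inj₁ u) = ¬u e∈ u
        absurd e∈ (inj₂ (_ , eq , _)) = case trans (sym a≡) eq of λ ()
      search-step li clear = clear-step refl li

    -- The invariant along an execution.

    still-idle : ∀ {t C G i} → Inv t C G → proc C i ≡ idle → A (mem C) i ≡ (nothing , nothing)
    still-idle {t} {C} {G} {i} inv idle≡ = subst (Assertions.ProcInv t C G i) idle≡ (Inv.procs inv i)

    local-step : ∀ {t C G i ps ps′ as} → Inv t C G → proc C i ≡ ps → (∀ {x} → ¬ Awaits x ps) →
      (∀ {x} → x ∈ allocated (mem C) → x ∈ as) →
      (∀ {g} → nodeOf ps′ ≡ just g → nodeOf ps ≡ just g ⊎ g ∉ allocated (mem C)) →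
      let m′ = record (mem C) { allocated = as } in
      Assertions.ProcInv (suc t) (moved C i m′ ps′) G i ps′ → Inv (suc t) (moved C i m′ ps′) G
    local-step {t} {C} {G} {i} {ps} {ps′} {as} inv refl ¬a alloc⊆ node inv-i =
      preserved inv refl
        (change-quiet {N = λ _ → ⊥} {t = t} mem-inv (heapStep-inv mem-inv hs) (heapStep-evolves mem-inv hs)
          inj₁ ¬a (λ _ → inj₁ refl))
        (λ _ _ → inj₁ refl) (λ ()) node inv-i
      where
      mem-inv = Inv.mem-inv inv
      hs : HeapStep (λ _ → ⊥) (mem C) G (record (mem C) { allocated = as })
      hs = heap-same refl refl alloc⊆

    pause-inv : ∀ {t C G} → Inv t C G → Inv (suc t) C G
    pause-inv {t} {C} {G} inv = record
      { mem-inv = mem-inv ; distinct = Inv.distinct inv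
      ; procs = λ i → Stability.procInv {t = t} unchanged (proc C i) (λ _ ()) (inj₁ refl) refl (Inv.procs inv i) }
      where
      mem-inv = Inv.mem-inv inv
      hs : HeapStep (λ _ → ⊥) (mem C) G (mem C)
      hs = heap-same refl refl λ x∈ → x∈
      unchanged : Change (λ _ → ⊥) C G C G
      unchanged = record
        { inv = mem-inv ; inv′ = mem-inv ; evolves = heapStep-evolves mem-inv hs ; ret-step = inj₁
        ; safe = λ _ _ _ sf → sf ; A-change = λ _ → inj₁ refl }

    step-inv : ∀ {t G ev C′} → Inv t (conf t) G → event t ≡ ev → conf t —[ ev ]→ C′ →
               (∃[ G′ ] Inv (suc t) C′ G′) × (∀ {x} → x ∈ allocated (mem (conf t)) → x ∈ allocated (mem C′))
    step-inv {G = G} inv ev (invoke idle≡) =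
      (G , local-step inv idle≡ (λ ()) (λ x∈ → x∈) (λ ()) (still-idle inv idle≡)) , λ x∈ → x∈
    step-inv {t} {G} inv ev (allocate {i} {e} {g} allocating≡ g∉) =
      (G , local-step inv allocating≡ (λ ()) there (λ { refl → inj₂ g∉ })
             (here refl , g∉ ∘ MemInv.pub⊆alloc (Inv.mem-inv inv) , a≡)) , there
      where
      a≡ : A (mem (conf t)) i ≡ (nothing , nothing)
      a≡ = subst (Assertions.ProcInv t (conf t) G i) allocating≡ (Inv.procs inv i)
    step-inv {t} {G} inv ev (access {i} {e} {g} {l} searching≡ st)
      with SearchPreservation.search-step inv ev searching≡
             (subst (Assertions.ProcInv t (conf t) G i) searching≡ (Inv.procs inv i)) st
    ... | G′ , ch , others , li =
      (G′ , preserved inv searching≡ ch others (cong just ∘ sym) inj₁ li) , Evolves.alloc⊆ (Change.evolves ch)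
    step-inv {t} {G} inv ev (return {i} returning≡) =
      (G , local-step inv returning≡ (λ ()) (λ x∈ → x∈) (λ ()) (proj₁ (proj₂ li))) , λ x∈ → x∈
      where li = subst (Assertions.ProcInv t (conf t) G i) returning≡ (Inv.procs inv i)
    step-inv {G = G} inv ev pause = (G , pause-inv inv) , λ x∈ → x∈

    -- The initial configuration.

    module _ (unique-items : Unique items) where

      private
        m₀ = mem (conf 0)
        module I₀ = Initial init

        unique-nodes-items : Unique (map (λ a → item (heap m₀ a)) I₀.nodes)
        unique-nodes-items = Unique-resp-↭ (setoid Item) (↭⇒↭ₛ (↭-sym I₀.nodes-items)) unique-items

        G₀ : Ghost
        G₀ = record { hist = I₀.nodes ; ret = [] ; pub = I₀.nodes }

        initially-done : ∀ {x} → x ∈ I₀.nodes → old (heap m₀ x) ≡ DONE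
        initially-done = All.lookup I₀.nodes-old

        -- The induction runs over suffixes of the list: since the nodes are distinct, members of a
        -- suffix keep their rank when a node is put in front.
        links : ∀ as {x y} → Unique as → DoublyLinked (heap m₀) y as → x ∈ as →
                MaybeAll.All (_∈ as) (next (heap m₀ x))
                × (∀ {v} → v ∈ as → rank as v < rank as x →
                   MaybeAny.Any (λ z → rank as v ≤ rank as z) (next (heap m₀ x)))
        links (a ∷ []) _ (_ , n≡ , _) (here refl) rewrite n≡ =
          MaybeAll.nothing , λ { (here refl) v<v → ⊥-elim (<-irrefl refl v<v) }
        links (a ∷ b ∷ as) (a∉ ∷ _) (_ , n≡ , _) (here refl) rewrite n≡ =
          MaybeAll.just (there (here refl)) , λ {v} v∈ v<a → MaybeAny.just (below v v<a)
          where
          below : ∀ v → rank (a ∷ b ∷ as) v < rank (a ∷ b ∷ as) a →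
                  rank (a ∷ b ∷ as) v ≤ rank (a ∷ b ∷ as) b
          below v v<a = subst (_≤ _) (sym (rank-tail (b ∷ as) λ { refl → <-irrefl refl v<a }))
            (≤-trans (rank≤head as v) (rank-∷ a (b ∷ as) b))
        links (a ∷ as) {x} (a∉ ∷ u) (_ , _ , dl) (there x∈) with links as u dl x∈
        ... | in-as , cov = MaybeAll.map there in-as , cov′
          where
          cov′ : ∀ {v} → v ∈ a ∷ as → rank (a ∷ as) v < rank (a ∷ as) x →
                 MaybeAny.Any (λ z → rank (a ∷ as) v ≤ rank (a ∷ as) z) (next (heap m₀ x))
          cov′ (here refl) v<x = ⊥-elim (<-irrefl refl (<-≤-trans v<x (rank≤head as x)))
          cov′ {v} (there v∈) v<x = MaybeAny.map
            (λ v≤z → subst (_≤ _) (sym v≡) (≤-trans v≤z (rank-∷ a as _)))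
            (cov v∈ (subst₂ _<_ v≡ (rank-tail as (All.lookup a∉ x∈ ∘ sym)) v<x))
            where v≡ = rank-tail as (All.lookup a∉ v∈ ∘ sym)

        initial-links : ∀ {x} → x ∈ I₀.nodes → Linked m₀ G₀ x
        initial-links x∈ with links I₀.nodes (Unique.map⁻ unique-nodes-items) I₀.nodes-linked x∈
        ... | in-nodes , cov = record
          { settled = MaybeAll.map (λ z∈ → z∈ , initially-done z∈) in-nodes
          ; covers = λ v∈ _ → cov v∈ }

        initial-inv : Inv 0 (conf 0) G₀
        initial-inv = record
          { mem-inv = record
            { front = I₀.first ; second = I₀.second ; rest = I₀.others
            ; hist≡ = refl ; Head≡ = I₀.Head≡
            ; hist⊆pub = λ x∈ → x∈
            ; pub⊆alloc = subst (_ ∈_) (sym I₀.allocated≡)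
            ; ret-settled = λ ()
            ; second-done = initially-done (there (here refl))
            ; behind-done = λ x∈ _ → initially-done x∈
            ; front-old = inj₁ (initially-done (here refl))
            ; item∈items = λ x∈ → ∈-resp-↭ I₀.nodes-items (∈-map⁺ _ x∈)
            ; live-copy = λ e∈ → let (v , v∈ , eq) = ∈-map⁻ _ (∈-resp-↭ (↭-sym I₀.nodes-items) e∈) in
                v , v∈ , (λ ()) , sym eq
            -- Initially no item has two copies, because the set is given without repetitions.
            ; superseded = λ x∈ y∈ y<x eq _ → ⊥-elim (<⇒≢ y<x
                (cong (rank I₀.nodes) (sym (Unique-map-injective _ unique-nodes-items x∈ y∈ eq))))
            ; new-ok = λ {x} x∈ → subst (NewOK m₀ G₀ x) (sym (All.lookup I₀.nodes-new x∈)) λ ()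
            ; linked = λ x∈ → inj₁ (initial-links x∈)
            ; unlisted = λ x∈ x∉ → ⊥-elim (x∉ x∈) }
          ; procs = λ i → subst (Assertions.ProcInv 0 (conf 0) G₀ i) (sym (I₀.proc≡ i)) (I₀.A≡ i)
          ; distinct = λ {i} n _ → case trans (sym (cong nodeOf (I₀.proc≡ i))) n of λ () }

      invariant : ∀ t → ∃[ G ] Inv t (conf t) G
      invariant zero    = G₀ , initial-inv
      invariant (suc t) = proj₁ (step-inv (proj₂ (invariant t)) refl (step t))

      allocated-mono : ∀ {x s t} → s ≤ t → x ∈ allocated (mem (conf s)) → x ∈ allocated (mem (conf t))
      allocated-mono s≤t = go (≤⇒≤′ s≤t)
        where
        go : ∀ {x s t} → s ≤′ t → x ∈ allocated (mem (conf s)) → x ∈ allocated (mem (conf t))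
        go (≤′-reflexive refl) x∈ = x∈
        go (≤′-step {t} s≤t) x∈ = proj₂ (step-inv (proj₂ (invariant t)) refl (step t)) (go s≤t x∈)

      -- Linearization points of a single search.

      module Linearization (op : CompletedSearch E) where
        open CompletedSearch op

        private
          j = process
          e = argument

        NoWithdrawal : ℕ → Set
        NoWithdrawal t = ∀ w → start < w → w < t → event w ≡ access j →
                         ∀ {g h₁} → proc (conf w) j ≢ searching e g (withdraw h₁)

        AfterWithdrawal : ℕ → Addr → Line → Set
        AfterWithdrawal t g l = ∃[ f ] (l ≡ returning (found (just f)) ⊎ ∃[ ab ] l ≡ clear ab (found (just f)))
                                     × HeadRead t j e g f

        -- A moment within this search at which `g` is still free; it separates the search from
        -- earlier ones of the same process.
        AllocatedSince : ℕ → Addr → Set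
        AllocatedSince t g = ∃[ a ] start < a × a < t × g ∉ allocated (mem (conf a))

        -- The state `returning r` does not show whether the search went through step (S4), yet the
        -- required linearization point depends on it. The phase preserves this piece of history:
        -- either no withdrawal has occurred so far, or the result is already fixed as the node read
        -- from `Head`.
        Phase : ℕ → ProcState → Set
        Phase t idle = ⊥
        Phase t (allocating e′) = e′ ≡ e × NoWithdrawal t
        Phase t (searching e′ g l) = e′ ≡ e × AllocatedSince t g × (NoWithdrawal t ⊎ AfterWithdrawal t g l)

        extend : ∀ {t} → NoWithdrawal t →
                 (event t ≡ access j → ∀ {g h₁} → proc (conf t) j ≢ searching e g (withdraw h₁)) →
                 NoWithdrawal (suc t)
        extend none at-t w s<w w<st ev with m≤n⇒m<n∨m≡n (s≤s⁻¹ w<st)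
        ... | inj₁ w<t  = none w s<w w<t ev
        ... | inj₂ refl = at-t ev

        allocatedSince⁺ : ∀ {t g} → AllocatedSince t g → AllocatedSince (suc t) g
        allocatedSince⁺ (a , s<a , a<t , g∉) = a , s<a , m≤n⇒m≤1+n a<t , g∉

        waiting : ∀ {t} → event t ≢ access j → ∀ ps → Phase t ps → Phase (suc t) ps
        waiting ne (allocating _) (eq , none) = eq , extend none (⊥-elim ∘ ne)
        waiting ne (searching _ _ _) (eq , al , inj₁ none) =
          eq , allocatedSince⁺ al , inj₁ (extend none (⊥-elim ∘ ne))
        waiting ne (searching _ _ _) (eq , al , inj₂ (f , l≡ , hr)) =
          eq , allocatedSince⁺ al , inj₂ (f , l≡ , headRead⁺ hr)

        withdraw? : ∀ l → (∃[ h₁ ] l ≡ withdraw h₁) ⊎ (∀ {h₁} → l ≢ withdraw h₁)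
        withdraw? (withdraw h₁)      = inj₁ (h₁ , refl)
        withdraw? writeItem          = inj₂ λ ()
        withdraw? writePrev          = inj₂ λ ()
        withdraw? writeNext          = inj₂ λ ()
        withdraw? writeOld           = inj₂ λ ()
        withdraw? writeNew           = inj₂ λ ()
        withdraw? announce           = inj₂ λ ()
        withdraw? readHead           = inj₂ λ ()
        withdraw? (compareFirst _ _) = inj₂ λ ()
        withdraw? (compareItem _ _)  = inj₂ λ ()
        withdraw? (checkAtItem _)    = inj₂ λ ()
        withdraw? (setOld _)         = inj₂ λ ()
        withdraw? (setNew _)         = inj₂ λ ()
        withdraw? (readNew _)        = inj₂ λ ()
        withdraw? (moveToFront _ _)  = inj₂ λ ()
        withdraw? readResult         = inj₂ λ ()
        withdraw? (checkPeriod _ _)  = inj₂ λ ()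
        withdraw? (advance _ _)      = inj₂ λ ()
        withdraw? checkAtEnd         = inj₂ λ ()
        withdraw? (clear _ _)        = inj₂ λ ()
        withdraw? (returning _)      = inj₂ λ ()

        withdrawn : ∀ {t g h₁ l′ m m′} → proc (conf t) j ≡ searching e g (withdraw h₁) →
                    SearchStep j e g (withdraw h₁) m l′ m′ → AfterWithdrawal (suc t) g l′
        withdrawn {t} {g} {h₁} at-j st
          with subst (Assertions.ProcInv t (conf t) _ j) at-j (Inv.procs (proj₂ (invariant t)) j)
        withdrawn at-j (withdraw-⊥ _)    | _ , f , refl , _ , _ , hr = f , inj₂ (_ , refl) , headRead⁺ hr
        withdrawn at-j (withdraw-item _) | _ , f , refl , _ , _ , hr = f , inj₁ refl , headRead⁺ hr

        after-withdrawal⁺ : ∀ {t g l l′ m m′} → SearchStep j e g l m l′ m′ →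
                            AfterWithdrawal t g l → AfterWithdrawal (suc t) g l′
        after-withdrawal⁺ ()    (f , inj₁ refl , hr)
        after-withdrawal⁺ clear (f , inj₂ (_ , refl) , hr) = f , inj₁ refl , headRead⁺ hr

        line-injective : ∀ {e e′ g g′ l l′} → searching e g l ≡ searching e′ g′ l′ → l ≡ l′
        line-injective refl = refl

        accessing : ∀ {t e′ g l l′ m m′} → proc (conf t) j ≡ searching e′ g l → SearchStep j e′ g l m l′ m′ →
                    Phase t (searching e′ g l) → Phase (suc t) (searching e′ g l′)
        accessing at-j st (refl , al , inj₂ after) =
          refl , allocatedSince⁺ al , inj₂ (after-withdrawal⁺ st after)
        accessing {l = l} at-j st (refl , al , inj₁ none) with withdraw? l
        ... | inj₁ (h₁ , refl) = refl , allocatedSince⁺ al , inj₂ (withdrawn at-j st)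
        ... | inj₂ l≢ =
          refl , allocatedSince⁺ al , inj₁ (extend none λ _ eq → l≢ (line-injective (trans (sym at-j) eq)))

        phase-step : ∀ {t ev C′} → start < t → t < end → event t ≡ ev → conf t —[ ev ]→ C′ →
                     Phase t (proc (conf t) j) → Phase (suc t) (proc C′ j)
        phase-step {t} s<t t<e ev (invoke {i} idle≡) ph with j Fin.≟ i
        ... | yes refl = ⊥-elim (subst (Phase t) idle≡ ph)
        ... | no j≢i = subst (Phase (suc t)) (sym (updateAt-minimal j i (proc (conf t)) j≢i))
          (waiting (λ eq → case trans (sym ev) eq of λ ()) _ ph)
        phase-step {t} s<t t<e ev (allocate {i} {g = g} allocating≡ g∉) ph with j Fin.≟ i
        ... | no j≢i = subst (Phase (suc t)) (sym (updateAt-minimal j i (proc (conf t)) j≢i))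
          (waiting (λ eq → case trans (sym ev) eq of λ { refl → j≢i refl }) _ ph)
        ... | yes refl with subst (Phase t) allocating≡ ph
        ...   | eq , none = subst (Phase (suc t)) (sym (updateAt-updates i (proc (conf t))))
          (eq , (t , s<t , ≤-refl , g∉) , inj₁ (extend none λ _ eq → case trans (sym allocating≡) eq of λ ()))
        phase-step {t} s<t t<e ev (access {i} searching≡ st) ph with j Fin.≟ i
        ... | no j≢i = subst (Phase (suc t)) (sym (updateAt-minimal j i (proc (conf t)) j≢i))
          (waiting (λ eq → case trans (sym ev) eq of λ { refl → j≢i refl }) _ ph)
        ... | yes refl = subst (Phase (suc t)) (sym (updateAt-updates i (proc (conf t))))
          (accessing searching≡ st (subst (Phase t) searching≡ ph))
        phase-step {t} s<t t<e ev (return {i} _) ph with j Fin.≟ i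
        ... | yes refl = ⊥-elim (pending t s<t t<e _ ev)
        ... | no j≢i = subst (Phase (suc t)) (sym (updateAt-minimal j i (proc (conf t)) j≢i))
          (waiting (λ eq → case trans (sym ev) eq of λ ()) _ ph)
        phase-step s<t t<e ev pause ph = waiting (λ eq → case trans (sym ev) eq of λ ()) _ ph

        first-phase : ∀ {C′} → conf start —[ invoke j e ]→ C′ → Phase (suc start) (proc C′ j)
        first-phase (invoke _) = subst (Phase (suc start)) (sym (updateAt-updates j (proc (conf start))))
          (refl , λ w s<w w<ss → ⊥-elim (<-irrefl refl (<-≤-trans s<w (s≤s⁻¹ w<ss))))

        phase : ∀ t → start < t → t ≤ end → Phase t (proc (conf t) j)
        phase (suc t) s<st st≤e with m≤n⇒m<n∨m≡n (s≤s⁻¹ s<st)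
        ... | inj₁ s<t  = phase-step s<t st≤e refl (step t) (phase t s<t (<⇒≤ st≤e))
        ... | inj₂ refl = first-phase (subst (λ ev → conf t —[ ev ]→ conf (suc t)) invoked (step t))

        at-return : ∀ {C′} → conf end —[ return j result ]→ C′ →
                    ∃[ e′ ] ∃[ g ] proc (conf end) j ≡ searching e′ g (returning result)
        at-return (return returning≡) = _ , _ , returning≡

        -- A process that announces `g` owns it, so `g` is allocated then and ever after. As `g` was
        -- free at some moment after the start, the announcement comes later and belongs to this
        -- search.
        announced-after-start : ∀ {g u} → u ≤ end → AllocatedSince end g → Announced u j e g →
                                ∃[ s ] PerformsAt E op announce s × s < u
        announced-after-start u≤e (a , st<a , _ , g∉) (s , s<u , ev , at-s) =
          s , (<-trans st<a (≰⇒> λ s≤a → g∉ (allocated-mono s≤a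
                 (node-allocated (proj₂ (invariant s)) (cong nodeOf at-s))))
              , <-≤-trans s<u u≤e , ev , _ , at-s) , s<u

        linearize : ∃[ t ] LinearizedAt E op t
        linearize with at-return (subst (λ ev → conf end —[ ev ]→ conf (suc end)) returned (step end))
        ... | e′ , g , returning≡
          with subst (Phase end) returning≡ (phase end start<end ≤-refl)
             | subst (Assertions.ProcInv end (conf end) _ j) returning≡ (Inv.procs (proj₂ (invariant end)) j)
        ... | refl , al , inj₂ (f , inj₁ refl , u , u<e , ev , at-u , an , first≡ , i≡) | _ , _ , _ , absent
          with announced-after-start (<⇒≤ u<e) al an
        ...   | s , perf , s<u = u , record
          { after-start = <-trans (proj₁ perf) s<u
          ; before-end  = <⇒≤ u<e
          ; present     = λ _ → f , refl , first≡ , i≡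
          ; absent      = absent
          ; at-read     = λ _ → <-trans (proj₁ perf) s<u , u<e , ev , _ , at-u
          ; announced   = λ _ _ → s , perf , s<u }
        linearize | e′ , g , returning≡ | refl , al , inj₁ none | _ , _ , present , absent
          with DecMembership._∈?_ _≟_ e items
        ... | no e∉ = end , record
          { after-start = start<end ; before-end = ≤-refl
          ; present = λ e∈ → ⊥-elim (e∉ e∈) ; absent = absent
          ; at-read = λ (w , _ , s<w , w<e , ev , _ , at-w) → ⊥-elim (none w s<w w<e ev at-w)
          ; announced = λ _ e∈ → ⊥-elim (e∉ e∈) }
        ... | yes e∈ with present e∈
        ...   | v , r≡ , u , u≤e , an , first≡ , i≡ with announced-after-start u≤e al an
        ...     | s , perf , s<u = u , record
          { after-start = <-trans (proj₁ perf) s<u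
          ; before-end  = u≤e
          ; present     = λ _ → v , r≡ , first≡ , i≡
          ; absent      = absent
          ; at-read     = λ (w , _ , s<w , w<e , ev , _ , at-w) → ⊥-elim (none w s<w w<e ev at-w)
          ; announced   = λ _ _ → s , perf , s<u }

theorem38 : (Item : Set) (_≟_ : DecidableEquality Item)
    (p φ : ℕ) .{{_ : NonZero φ}}
    (items : List Item) → Unique items → 2 ≤ length items →
    let open DMTF Item _≟_ p φ items in
    (E : Execution) →
    Σ[ lin ∈ (CompletedSearch E → ℕ) ] ((op : CompletedSearch E) → LinearizedAt E op (lin op))
theorem38 Item _≟_ p φ items unique-items _ E =
  (λ op → proj₁ (linearize op)) , λ op → proj₂ (linearize op)
  where
  linearize = Correctness.Run.Linearization.linearize Item _≟_ p φ items E unique-items
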